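{- Let $\mathbf{H}\in\mathbb{R}^{m\times n}$, $\mathbf{y}\in\mathbb{R}^m$, $\mathbf{w}\in\mathcal{K}_{m+}\setminus\{\mathbf{0}\}\subset\mathbb{R}^n$, $\varepsilon>0$, and $f(\mathbf{x})=\tfrac12\|\mathbf{H}\mathbf{x}-\mathbf{y}\|_2^2$. Consider the problem $$\min_{\mathbf{x}\in\mathbb{R}^n} \tfrac12\|\mathbf{y}-\mathbf{H}\mathbf{x}\|_2^2\quad\text{s.t.}\quad \Omega_{\mathbf{w}}(\mathbf{x})\le\varepsilon,$$ with $\mathbf{x}^*$ denoting one of its solutions, and the conditional gradient algorithm with exact line search applied to this problem (described in the context). Then the iterates $\mathbf{x}_k$ of the algorithm satisfy $$f(\mathbf{x}_k)-f(\mathbf{x}^*)\le\frac{8\,\varepsilon^2 L}{\bar{w}^2\,(k+2)},$$ where $L=\lambda_{\max}(\mathbf{H}^T\mathbf{H})$ is the largest eigenvalue of $\mathbf{H}^T\mathbf{H}$ and $\bar{w}=\|\mathbf{w}\|_1/n$ is the average of the weights.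
   Context: $\mathcal{K}_{m+}=\{\mathbf{x}\in\mathbb{R}^n: x_1\ge x_2\ge\cdots\ge x_n\ge 0\}$ is the monotone non-negative cone. The ordered weighted $\ell_1$ (OWL) norm is $\Omega_{\mathbf{w}}(\mathbf{x})=\sum_{i=1}^n w_i\,|x|_{[i]}$, where $|x|_{[1]}\ge\cdots\ge|x|_{[n]}$ are the absolute values of the components of $\mathbf{x}$ sorted in non-increasing order. Let $\mathcal{G}_\varepsilon^{\mathbf{w}}=\{\mathbf{x}\in\mathbb{R}^n:\Omega_{\mathbf{w}}(\mathbf{x})\le\varepsilon\}$. The conditional gradient (Frank–Wolfe) algorithm is initialized with some $\mathbf{x}_0\in\mathcal{G}_\varepsilon^{\mathbf{w}}$ and, for $k=0,1,2,\dots$, computes: $\mathbf{g}_k=\mathbf{H}^T(\mathbf{y}-\mathbf{H}\mathbf{x}_k)$ (the negative gradient $-\nabla f(\mathbf{x}_k)$); $\mathbf{s}_k\in\arg\max_{\mathbf{s}\in\mathcal{G}_\varepsilon^{\mathbf{w}}}\mathbf{s}^T\mathbf{g}_k$; $\gamma_k\in\arg\min_{\gamma\in[0,1]}f(\mathbf{x}_k+\gamma(\mathbf{s}_k-\mathbf{x}_k))$; $\mathbf{x}_{k+1}=\mathbf{x}_k+\gamma_k(\mathbf{s}_k-\mathbf{x}_k)$.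
   Formalization: The bound is stated for k ≥ 1 only: for the arbitrary feasible starting point x_0 it fails (m = n = 1, H = 1, w = 1, ε = 1, y = 3, x_0 = −1, x* = 1 gives f(x_0) − f(x*) = 6 > 4). -}

module Defs where

open import Algebra.Bundles using (CommutativeRing)
open import Algebra.Core using (Op₁)
open import Data.Fin.Base as Fin using (Fin)
open import Data.List.Base using (length; lookup)
open import Data.List.Properties using (length-tabulate)
open import Data.List.Relation.Binary.Permutation.Propositional.Properties using (↭-length)
open import Data.Nat.Base as ℕ using (ℕ)
open import Data.Product.Base using (∃; _×_)
open import Data.Sum.Base using ([_,_]′)
open import Data.Vec.Functional using (Vector; map; zipWith; toList)
open import Function.Base using (const)
open import Level using (Level; _⊔_) renaming (suc to ℓsuc)
open import Relation.Binary.Bundles using (DecTotalOrder)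
open import Relation.Binary.Core using (Rel)
open import Relation.Binary.Structures using (IsDecTotalOrder)
open import Relation.Binary.PropositionalEquality.Core as ≡ using (_≡_)
open import Relation.Nullary.Negation.Core using (¬_)
open import Relation.Unary using (Pred; _∈_; Satisfiable)

import Algebra.Definitions.RawMonoid as RawMonoidOps
import Data.List.Sort as Sort
import Relation.Binary.Construct.Flip.EqAndOrd as Flip
import Relation.Binary.Construct.NonStrictToStrict as Strict

-- The classical axioms of ℝ, which determine it up to isomorphism.  The value
-- of 0# ⁻¹ is left unspecified.
record CompleteOrderedField (c ℓ₁ ℓ₂ : Level) : Set (ℓsuc (c ⊔ ℓ₁ ⊔ ℓ₂)) where
  infix 8 _⁻¹
  infixl 7 _/_
  infix 4 _≤_
  field
    commutativeRing : CommutativeRing c ℓ₁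
  open CommutativeRing commutativeRing public
  field
    _≤_             : Rel Carrier ℓ₂
    isDecTotalOrder : IsDecTotalOrder _≈_ _≤_
    _⁻¹             : Op₁ Carrier

  UpperBound : ∀ {ℓ} → Pred Carrier ℓ → Pred Carrier (c ⊔ ℓ₂ ⊔ ℓ)
  UpperBound P u = ∀ x → x ∈ P → x ≤ u

  field
    0≉1         : ¬ (0# ≈ 1#)
    *-inverseʳ  : ∀ x → ¬ (x ≈ 0#) → x * x ⁻¹ ≈ 1#
    +-monoʳ-≤   : ∀ z {x y} → x ≤ y → z + x ≤ z + y
    *-nonNeg    : ∀ {x y} → 0# ≤ x → 0# ≤ y → 0# ≤ x * y
    supremum    : (P : Pred Carrier (c ⊔ ℓ₁ ⊔ ℓ₂)) →
                  Satisfiable P → Satisfiable (UpperBound P) →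
                  ∃ λ s → UpperBound P s × (∀ u → u ∈ UpperBound P → s ≤ u)

  decTotalOrder : DecTotalOrder c ℓ₁ ℓ₂
  decTotalOrder = record { isDecTotalOrder = isDecTotalOrder }

  open Strict _≈_ _≤_ public using (_<_)

  _/_ : Carrier → Carrier → Carrier
  x / y = x * y ⁻¹

  ∣_∣ : Op₁ Carrier
  ∣ x ∣ = [ const x , const (- x) ]′ (IsDecTotalOrder.total isDecTotalOrder 0# x)

  open RawMonoidOps +-rawMonoid public using (sum)

  fromℕ : ℕ → Carrier
  fromℕ n = RawMonoidOps._×_ +-rawMonoid n 1#

module LinearAlgebra {c ℓ₁ ℓ₂} (𝓡 : CompleteOrderedField c ℓ₁ ℓ₂) where
  open CompleteOrderedField 𝓡

  infixl 7 _∙_ _*ᵥ_ _*ₘ_ _*ₛ_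
  infixl 6 _+ᵥ_ _-ᵥ_
  infix  4 _≈ᵥ_
  infix  9 _ᵀ

  ℝ^ : ℕ → Set c
  ℝ^ n = Vector Carrier n

  Matrix : ℕ → ℕ → Set c
  Matrix m n = Fin m → Fin n → Carrier

  _≈ᵥ_ : ∀ {n} → Rel (ℝ^ n) ℓ₁
  x ≈ᵥ y = ∀ i → x i ≈ y i

  0ᵥ : ∀ {n} → ℝ^ n
  0ᵥ _ = 0#

  _+ᵥ_ _-ᵥ_ : ∀ {n} → ℝ^ n → ℝ^ n → ℝ^ n
  _+ᵥ_ = zipWith _+_
  _-ᵥ_ = zipWith _-_

  _*ₛ_ : ∀ {n} → Carrier → ℝ^ n → ℝ^ n
  a *ₛ x = map (a *_) x

  _∙_ : ∀ {n} → ℝ^ n → ℝ^ n → Carrier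
  x ∙ y = sum (zipWith _*_ x y)

  _*ᵥ_ : ∀ {m n} → Matrix m n → ℝ^ n → ℝ^ m
  (A *ᵥ x) i = A i ∙ x

  _ᵀ : ∀ {m n} → Matrix m n → Matrix n m
  (A ᵀ) j i = A i j

  _*ₘ_ : ∀ {l m n} → Matrix l m → Matrix m n → Matrix l n
  (A *ₘ B) i k = A i ∙ (B ᵀ) k

  ‖_‖₂² : ∀ {n} → ℝ^ n → Carrier
  ‖ x ‖₂² = sum (map (λ t → t * t) x)

  ‖_‖₁ : ∀ {n} → ℝ^ n → Carrier
  ‖ x ‖₁ = sum (map ∣_∣ x)

  IsEigenvalue : ∀ {n} → Matrix n n → Carrier → Set (c ⊔ ℓ₁)
  IsEigenvalue A μ = ∃ λ v → ¬ (v ≈ᵥ 0ᵥ) × (A *ᵥ v ≈ᵥ μ *ₛ v)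

  -- Only real eigenvalues are considered; a symmetric matrix has no others.
  IsLargestEigenvalue : ∀ {n} → Matrix n n → Carrier → Set (c ⊔ ℓ₁ ⊔ ℓ₂)
  IsLargestEigenvalue A μ =
    IsEigenvalue A μ × (∀ ν → IsEigenvalue A ν → ν ≤ μ)

module Optimization {c ℓ₁ ℓ₂} (𝓡 : CompleteOrderedField c ℓ₁ ℓ₂) where
  open CompleteOrderedField 𝓡

  module _ {a ℓ} {A : Set a} (φ : A → Carrier) (S : Pred A ℓ) where

    ArgMin ArgMax : Pred A (a ⊔ ℓ ⊔ ℓ₂)
    ArgMin x = x ∈ S × (∀ z → z ∈ S → φ x ≤ φ z)
    ArgMax x = x ∈ S × (∀ z → z ∈ S → φ z ≤ φ x)

  UnitInterval : Pred Carrier ℓ₂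
  UnitInterval γ = 0# ≤ γ × γ ≤ 1#

module OWL {c ℓ₁ ℓ₂} (𝓡 : CompleteOrderedField c ℓ₁ ℓ₂) where
  open CompleteOrderedField 𝓡
  open LinearAlgebra 𝓡
  open Optimization 𝓡
  open Sort (Flip.decTotalOrder decTotalOrder) using (sort; sort-↭)

  MonotoneNonNegCone : ∀ {n} → Pred (ℝ^ n) ℓ₂
  MonotoneNonNegCone x = (∀ i j → i Fin.≤ j → x j ≤ x i) × (∀ i → 0# ≤ x i)

  average : ∀ {n} → ℝ^ n → Carrier
  average {n} w = ‖ w ‖₁ / fromℕ n

  -- The order is flipped, so `sort` is non-increasing.
  sorted : ∀ {n} → ℝ^ n → ℝ^ n
  sorted {n} x i = lookup (sort (toList x)) (Fin.cast length-sort i)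
    where
    length-sort : n ≡ length (sort (toList x))
    length-sort = ≡.sym (≡.trans (↭-length (sort-↭ (toList x))) (length-tabulate x))

  Ω : ∀ {n} → ℝ^ n → ℝ^ n → Carrier
  Ω w x = w ∙ sorted (map ∣_∣ x)

  Ball : ∀ {n} → ℝ^ n → Carrier → Pred (ℝ^ n) ℓ₂
  Ball w ε x = Ω w x ≤ ε

  module LeastSquares {m n} (H : Matrix m n) (y : ℝ^ m) where

    objective : ℝ^ n → Carrier
    objective x = fromℕ 2 ⁻¹ * ‖ H *ᵥ x -ᵥ y ‖₂²

    negGradient : ℝ^ n → ℝ^ n
    negGradient x = H ᵀ *ᵥ (y -ᵥ H *ᵥ x)

    -- `x`, `s` and `γ` form a possible run of the algorithm; the selections
    -- from the argmax and argmin sets are arbitrary.  The starting point `x 0`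
    -- is unrestricted in the ball, so no rate depending only on w, ε and the
    -- spectrum of H can hold for it; the computed iterates are `x k`, k ≥ 1.
    record IsConditionalGradient (w : ℝ^ n) (ε : Carrier)
             (x s : ℕ → ℝ^ n) (γ : ℕ → Carrier) : Set (c ⊔ ℓ₁ ⊔ ℓ₂) where
      field
        initial    : x 0 ∈ Ball w ε
        oracle     : ∀ k → s k ∈ ArgMax (_∙ negGradient (x k)) (Ball w ε)
        lineSearch : ∀ k → γ k ∈ ArgMin
                       (λ t → objective (x k +ᵥ t *ₛ (s k -ᵥ x k))) UnitInterval
        update     : ∀ k → x (ℕ.suc k) ≈ᵥ x k +ᵥ γ k *ₛ (s k -ᵥ x k)

{-# OPTIONS --safe #-}

-- Each step of the conditional gradient method with step size t satisfies
-- h′ ≤ (1 - t) h + (t²/2) ‖H (s - x)‖², where h = f(x) - f(x*).  Two facts turn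
-- this into the stated rate, with t = 2/(k + 2).  First, w̄ ‖x‖₂ ≤ w̄ ‖x‖₁ ≤ Ω x
-- by Chebyshev's sum inequality, so ‖s - x‖₂ ≤ 2ε/w̄.  Second, ‖H v‖² ≤ L ‖v‖²:
-- with μ the supremum of the Rayleigh quotients, completing the square
-- repeatedly shows that the positive semidefinite form μ ‖v‖² - ‖H v‖² is either
-- bounded below by a positive multiple of ‖v‖², so that μ could be decreased, or
-- vanishes at some v ≠ 0, which is then an eigenvector of HᵀH for μ.  So μ ≤ L,
-- and no compactness argument is needed.
module Submission where

import Algebra.Properties.AbelianGroup as AbelianGroupProperties
import Algebra.Properties.Ring as RingProperties
import Algebra.Properties.Semiring.Mult as SemiringMult
import Algebra.Properties.Semiring.Sum as SemiringSum
import Algebra.Solver.Ring as RingSolver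
open import Algebra.Solver.Ring.AlmostCommutativeRing
  using (fromCommutativeRing; _-Raw-AlmostCommutative⟶_)
open import Data.Fin.Base as Fin using (zero; suc)
import Data.Fin.Properties as Fin
open import Data.Integer.Base as ℤ using (ℤ; +_; -[1+_]; _⊖_)
import Data.Integer.Properties as ℤ
open import Data.List.Base as List using (List; []; _∷_)
open import Data.List.Properties using (length-tabulate)
open import Data.List.Relation.Binary.Permutation.Propositional using (↭⇒↭ₛ′)
open import Data.List.Relation.Binary.Permutation.Propositional.Properties using (↭-length)
import Data.List.Relation.Binary.Permutation.Setoid.Properties as SetoidPermutation
import Data.List.Relation.Unary.Sorted.TotalOrder.Properties as Sorted
import Data.List.Sort as Sort
import Data.Maybe.Base as Maybe
open import Data.Nat.Base as ℕ using (ℕ; zero; suc)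
import Data.Nat.Properties as ℕ
open import Data.Product.Base using (_×_; _,_; proj₁; proj₂; ∃; ∃₂)
open import Data.Sum.Base using (_⊎_; inj₁; inj₂)
open import Data.Vec.Functional using (tail; map; toList) renaming (_∷_ to _∷ᵥ_)
open import Level using (_⊔_)
open import Relation.Binary.Bundles using (DecTotalOrder)
import Relation.Binary.Construct.Flip.EqAndOrd as Flip
open import Relation.Binary.PropositionalEquality.Core as ≡ using (_≡_)
import Relation.Binary.Reasoning.Setoid as SetoidReasoning
open import Relation.Binary.Structures using (IsDecTotalOrder)
open import Relation.Nullary.Decidable.Core using (yes; no; dec⇒maybe)
open import Relation.Nullary.Negation.Core using (¬_; contradiction)
open import Relation.Unary using (_∈_)
open import Defs

-- A commutative ring solver with integer coefficients.

module IntegerCoefficients {c ℓ₁ ℓ₂} (𝓡 : CompleteOrderedField c ℓ₁ ℓ₂) where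
  open CompleteOrderedField 𝓡
  open RingProperties ring using (-‿distribˡ-*; -0#≈0#; -‿involutive)
  open AbelianGroupProperties +-abelianGroup using (⁻¹-∙-comm)
  open SemiringMult semiring using (×-homo-+; ×1-homo-*)
  open SetoidReasoning setoid

  -- Agrees with `fromℕ` definitionally on closed numerals, except that 1 is
  -- sent to 1# itself rather than to 1# + 0#.
  ι : ℕ → Carrier
  ι 0 = 0#
  ι 1 = 1#
  ι (suc (suc n)) = fromℕ (suc (suc n))

  ι≈fromℕ : ∀ n → ι n ≈ fromℕ n
  ι≈fromℕ 0 = refl
  ι≈fromℕ 1 = sym (+-identityʳ 1#)
  ι≈fromℕ (suc (suc n)) = refl

  ι-+ : ∀ m n → ι (m ℕ.+ n) ≈ ι m + ι n
  ι-+ m n = trans (ι≈fromℕ (m ℕ.+ n)) (trans (×-homo-+ 1# m n)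
    (sym (+-cong (ι≈fromℕ m) (ι≈fromℕ n))))

  ι-* : ∀ m n → ι (m ℕ.* n) ≈ ι m * ι n
  ι-* m n = trans (ι≈fromℕ (m ℕ.* n)) (trans (×1-homo-* m n)
    (sym (*-cong (ι≈fromℕ m) (ι≈fromℕ n))))

  fromℤ : ℤ → Carrier
  fromℤ (+ n)    = ι n
  fromℤ -[1+ n ] = - ι (suc n)

  fromℤ-neg : ∀ i → fromℤ (ℤ.- i) ≈ - fromℤ i
  fromℤ-neg (+ zero)  = sym -0#≈0#
  fromℤ-neg (+ suc n) = refl
  fromℤ-neg -[1+ n ]  = sym (-‿involutive _)

  fromℤ-⊖ : ∀ m n → fromℤ (m ⊖ n) ≈ ι m - ι n
  fromℤ-⊖ m zero = sym (trans (+-congˡ -0#≈0#) (+-identityʳ _))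
  fromℤ-⊖ zero (suc n) = sym (+-identityˡ _)
  fromℤ-⊖ (suc m) (suc n) = begin
    fromℤ (suc m ⊖ suc n)        ≡⟨ ≡.cong fromℤ (ℤ.[1+m]⊖[1+n]≡m⊖n m n) ⟩
    fromℤ (m ⊖ n)                ≈⟨ fromℤ-⊖ m n ⟩
    ι m - ι n                    ≈⟨ +-congʳ (+-identityʳ _) ⟨
    (ι m + 0#) - ι n             ≈⟨ +-congʳ (+-congˡ (-‿inverseʳ 1#)) ⟨
    (ι m + (1# - 1#)) - ι n      ≈⟨ +-congʳ (+-assoc _ _ _) ⟨
    ((ι m + 1#) - 1#) - ι n      ≈⟨ +-congʳ (+-congʳ (+-comm _ _)) ⟩
    ((1# + ι m) - 1#) - ι n      ≈⟨ +-assoc _ _ _ ⟩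
    (1# + ι m) + (- 1# - ι n)    ≈⟨ +-congˡ (⁻¹-∙-comm 1# (ι n)) ⟩
    (1# + ι m) - (1# + ι n)      ≈⟨ +-cong (ι-+ 1 m) (-‿cong (ι-+ 1 n)) ⟨
    ι (suc m) - ι (suc n)        ∎

  fromℤ-+ : ∀ i j → fromℤ (i ℤ.+ j) ≈ fromℤ i + fromℤ j
  fromℤ-+ (+ m) (+ n) = ι-+ m n
  fromℤ-+ (+ m) -[1+ n ] = fromℤ-⊖ m (suc n)
  fromℤ-+ -[1+ m ] (+ n) = trans (fromℤ-⊖ n (suc m)) (+-comm _ _)
  fromℤ-+ -[1+ m ] -[1+ n ] = begin
    - ι (2 ℕ.+ (m ℕ.+ n))         ≡⟨ ≡.cong (λ k → - ι (suc k)) (≡.sym (ℕ.+-suc m n)) ⟩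
    - ι (suc m ℕ.+ suc n)         ≈⟨ -‿cong (ι-+ (suc m) (suc n)) ⟩
    - (ι (suc m) + ι (suc n))     ≈⟨ ⁻¹-∙-comm _ _ ⟨
    - ι (suc m) - ι (suc n)       ∎

  fromℤ-*-pos : ∀ m j → fromℤ (+ m ℤ.* j) ≈ ι m * fromℤ j
  fromℤ-*-pos m (+ n) = trans (reflexive (≡.cong fromℤ (≡.sym (ℤ.pos-* m n)))) (ι-* m n)
  fromℤ-*-pos m -[1+ n ] = begin
    fromℤ (+ m ℤ.* -[1+ n ])      ≡⟨ ≡.cong fromℤ (≡.sym (ℤ.neg-distribʳ-* (+ m) (+ suc n))) ⟩
    fromℤ (ℤ.- (+ m ℤ.* + suc n)) ≈⟨ fromℤ-neg (+ m ℤ.* + suc n) ⟩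
    - fromℤ (+ m ℤ.* + suc n)     ≈⟨ -‿cong (fromℤ-*-pos m (+ suc n)) ⟩
    - (ι m * ι (suc n))           ≈⟨ RingProperties.-‿distribʳ-* ring _ _ ⟩
    ι m * - ι (suc n)             ∎

  fromℤ-* : ∀ i j → fromℤ (i ℤ.* j) ≈ fromℤ i * fromℤ j
  fromℤ-* (+ m) j = fromℤ-*-pos m j
  fromℤ-* -[1+ m ] j = begin
    fromℤ (-[1+ m ] ℤ.* j)        ≡⟨ ≡.cong fromℤ (≡.sym (ℤ.neg-distribˡ-* (+ suc m) j)) ⟩
    fromℤ (ℤ.- (+ suc m ℤ.* j))   ≈⟨ fromℤ-neg (+ suc m ℤ.* j) ⟩
    - fromℤ (+ suc m ℤ.* j)       ≈⟨ -‿cong (fromℤ-*-pos (suc m) j) ⟩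
    - (ι (suc m) * fromℤ j)       ≈⟨ -‿distribˡ-* _ _ ⟩
    - ι (suc m) * fromℤ j         ∎

  -- Equality of integers computes, so the solver can normalise numerals. The constants 0, 1, 2 and
  -- so on evaluate by definition to `0#`, `1#`, `fromℕ 2`, so solved identities fit goals with such
  -- numerals directly.
  morphism : ℤ.+-*-rawRing -Raw-AlmostCommutative⟶ fromCommutativeRing commutativeRing
  morphism = record
    { ⟦_⟧    = fromℤ
    ; +-homo = fromℤ-+
    ; *-homo = fromℤ-*
    ; -‿homo = fromℤ-neg
    ; 0-homo = refl
    ; 1-homo = refl
    }

  open RingSolver ℤ.+-*-rawRing (fromCommutativeRing commutativeRing) morphism
    (λ i j → Maybe.map (λ eq → reflexive (≡.cong fromℤ eq)) (dec⇒maybe (i ℤ.≟ j)))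
    public using (solve; _:=_; _:+_; _:*_; _:-_; :-_; con)

-- Order and division in an ordered field.

module OrderedFieldProperties {c ℓ₁ ℓ₂} (𝓡 : CompleteOrderedField c ℓ₁ ℓ₂) where
  open CompleteOrderedField 𝓡
  open IntegerCoefficients 𝓡
  open IsDecTotalOrder isDecTotalOrder using (total; antisym; _≟_)
    renaming (trans to ≤-trans; refl to ≤-refl; reflexive to ≤-reflexive;
              ≤-respʳ-≈ to ≤-respʳ; ≤-respˡ-≈ to ≤-respˡ) public

  x≤y⇒0≤y-x : ∀ {x y} → x ≤ y → 0# ≤ y - x
  x≤y⇒0≤y-x {x} {y} x≤y = ≤-respˡ (-‿inverseˡ x)
    (≤-respʳ (+-comm (- x) y) (+-monoʳ-≤ (- x) x≤y))

  -- Certificate form of an inequality: `d` is a sum of visibly nonnegative terms, and its identity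
  -- with `y - x` is left to the solver. Most polynomial inequalities below are proved this way.
  ≤-from : ∀ {x y d} → 0# ≤ d → d ≈ y - x → x ≤ y
  ≤-from {x} {y} {d} 0≤d d≈y-x = ≤-respˡ (+-identityʳ x)
    (≤-respʳ (trans (+-congˡ d≈y-x)
                    (solve 2 (λ x y → x :+ (y :- x) := y) refl x y))
             (+-monoʳ-≤ x 0≤d))

  0≤+ : ∀ {x y} → 0# ≤ x → 0# ≤ y → 0# ≤ x + y
  0≤+ {x} {y} 0≤x 0≤y = ≤-trans 0≤x (≤-from 0≤y (solve 2 (λ x y → y := x :+ y :- x) refl x y))

  x≤0⇒0≤-x : ∀ {x} → x ≤ 0# → 0# ≤ - x
  x≤0⇒0≤-x {x} x≤0 = ≤-respʳ (+-identityˡ (- x)) (x≤y⇒0≤y-x x≤0)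

  *-monoˡ-≤ : ∀ {a x y} → 0# ≤ a → x ≤ y → a * x ≤ a * y
  *-monoˡ-≤ {a} {x} {y} 0≤a x≤y = ≤-from (*-nonNeg 0≤a (x≤y⇒0≤y-x x≤y))
    (solve 3 (λ a x y → a :* (y :- x) := a :* y :- a :* x) refl a x y)

  0≤square : ∀ x → 0# ≤ x * x
  0≤square x with total 0# x
  ... | inj₁ 0≤x = *-nonNeg 0≤x 0≤x
  ... | inj₂ x≤0 = ≤-respʳ (solve 1 (λ x → (:- x) :* (:- x) := x :* x) refl x)
    (*-nonNeg (x≤0⇒0≤-x x≤0) (x≤0⇒0≤-x x≤0))

  0≤1 : 0# ≤ 1#
  0≤1 = ≤-respʳ (*-identityˡ 1#) (0≤square 1#)

  0<1 : 0# < 1#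
  0<1 = 0≤1 , 0≉1

  <⇒≰ : ∀ {x y} → x < y → ¬ (y ≤ x)
  <⇒≰ (x≤y , x≉y) y≤x = x≉y (antisym x≤y y≤x)

  positive? : ∀ x → 0# < x ⊎ x ≤ 0#
  positive? x with total 0# x | 0# ≟ x
  ... | inj₂ x≤0 | _       = inj₂ x≤0
  ... | inj₁ 0≤x | no 0≉x  = inj₁ (0≤x , 0≉x)
  ... | inj₁ 0≤x | yes 0≈x = inj₂ (≤-reflexive (sym 0≈x))

  <-≤-trans : ∀ {x y z} → x < y → y ≤ z → x < z
  <-≤-trans (x≤y , x≉y) y≤z = ≤-trans x≤y y≤z , λ x≈z → x≉y (antisym x≤y (≤-respʳ (sym x≈z) y≤z))

  <-respʳ : ∀ {x y z} → y ≈ z → x < y → x < z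
  <-respʳ y≈z x<y = <-≤-trans x<y (≤-reflexive y≈z)

  x*y≈0⇒y≈0 : ∀ {x y} → ¬ (x ≈ 0#) → x * y ≈ 0# → y ≈ 0#
  x*y≈0⇒y≈0 {x} {y} x≉0 xy≈0 = begin
    y              ≈⟨ *-identityˡ y ⟨
    1# * y         ≈⟨ *-congʳ (*-inverseʳ x x≉0) ⟨
    x * x ⁻¹ * y   ≈⟨ solve 3 (λ x i y → x :* i :* y := x :* y :* i) refl x (x ⁻¹) y ⟩
    x * y * x ⁻¹   ≈⟨ *-congʳ xy≈0 ⟩
    0# * x ⁻¹      ≈⟨ zeroˡ _ ⟩
    0#             ∎
    where open SetoidReasoning setoid

  x*x≤0⇒x≈0 : ∀ {x} → x * x ≤ 0# → x ≈ 0#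
  x*x≤0⇒x≈0 {x} xx≤0 with x ≟ 0#
  ... | yes x≈0 = x≈0
  ... | no x≉0 = x*y≈0⇒y≈0 x≉0 (antisym xx≤0 (0≤square x))

  *-pos : ∀ {x y} → 0# < x → 0# < y → 0# < x * y
  *-pos (0≤x , 0≉x) (0≤y , 0≉y) = *-nonNeg 0≤x 0≤y ,
    λ 0≈xy → 0≉y (sym (x*y≈0⇒y≈0 (λ x≈0 → 0≉x (sym x≈0)) (sym 0≈xy)))

  +-pos : ∀ {x y} → 0# < x → 0# ≤ y → 0# < x + y
  +-pos {x} {y} 0<x 0≤y = <-≤-trans 0<x (≤-from 0≤y (solve 2 (λ x y → y := x :+ y :- x) refl x y))

  inverseʳ : ∀ {x} → 0# < x → x * x ⁻¹ ≈ 1#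
  inverseʳ {x} (_ , 0≉x) = *-inverseʳ x (λ x≈0 → 0≉x (sym x≈0))

  -- If x ≤ 0, then a x is both nonpositive and nonnegative, hence zero, which forces x to vanish.
  *-cancelˡ-nonNeg : ∀ {a x} → 0# < a → 0# ≤ a * x → 0# ≤ x
  *-cancelˡ-nonNeg {a} {x} 0<a 0≤ax with total 0# x
  ... | inj₁ 0≤x = 0≤x
  ... | inj₂ x≤0 = ≤-reflexive (sym (x*y≈0⇒y≈0 (λ a≈0 → proj₂ 0<a (sym a≈0)) (antisym
    (≤-respʳ (zeroʳ a) (*-monoˡ-≤ (proj₁ 0<a) x≤0)) 0≤ax)))

  *-cancelˡ-≤ : ∀ {a x y} → 0# < a → a * x ≤ a * y → x ≤ y
  *-cancelˡ-≤ {a} {x} {y} 0<a ax≤ay = ≤-from (*-cancelˡ-nonNeg 0<a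
    (≤-respʳ (solve 3 (λ a x y → a :* y :- a :* x := a :* (y :- x)) refl a x y)
      (x≤y⇒0≤y-x ax≤ay))) refl

  ⁻¹-pos : ∀ {x} → 0# < x → 0# < x ⁻¹
  ⁻¹-pos {x} 0<x = *-cancelˡ-nonNeg 0<x (≤-respʳ (sym (inverseʳ 0<x)) 0≤1) ,
    λ 0≈x⁻¹ → 0≉1 (trans (sym (zeroʳ x)) (trans (*-congˡ 0≈x⁻¹) (inverseʳ 0<x)))

  *-/-cancel : ∀ {d} x → 0# < d → d * (x / d) ≈ x
  *-/-cancel {d} x 0<d = trans (solve 3 (λ d x i → d :* (x :* i) := d :* i :* x) refl d x (d ⁻¹))
    (trans (*-congʳ (inverseʳ 0<d)) (*-identityˡ x))

  ≤-/ : ∀ {x d z} → 0# < d → d * x ≤ z → x ≤ z / d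
  ≤-/ {x} {d} {z} 0<d dx≤z = *-cancelˡ-≤ 0<d (≤-respʳ (sym (*-/-cancel z 0<d)) dx≤z)

  fromℕ-nonNeg : ∀ n → 0# ≤ fromℕ n
  fromℕ-nonNeg zero    = ≤-refl
  fromℕ-nonNeg (suc n) = 0≤+ 0≤1 (fromℕ-nonNeg n)

  fromℕ-pos : ∀ n → 0# < fromℕ (suc n)
  fromℕ-pos n = +-pos 0<1 (fromℕ-nonNeg n)

  ∣x∣-nonNeg : ∀ x → 0# ≤ ∣ x ∣
  ∣x∣-nonNeg x with total 0# x
  ... | inj₁ 0≤x = 0≤x
  ... | inj₂ x≤0 = x≤0⇒0≤-x x≤0

  ∣x∣*∣x∣≈x*x : ∀ x → ∣ x ∣ * ∣ x ∣ ≈ x * x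
  ∣x∣*∣x∣≈x*x x with total 0# x
  ... | inj₁ _ = refl
  ... | inj₂ _ = solve 1 (λ x → (:- x) :* (:- x) := x :* x) refl x

  nonNeg⇒∣x∣≈x : ∀ {x} → 0# ≤ x → ∣ x ∣ ≈ x
  nonNeg⇒∣x∣≈x {x} 0≤x with total 0# x
  ... | inj₁ _   = refl
  ... | inj₂ x≤0 = trans (-‿cong x≈0) (trans -0#≈0# (sym x≈0))
    where
    x≈0 = antisym x≤0 0≤x
    open RingProperties ring using (-0#≈0#)

-- Inner products, squared norms and adjoints.

module VectorProperties {c ℓ₁ ℓ₂} (𝓡 : CompleteOrderedField c ℓ₁ ℓ₂) where
  open CompleteOrderedField 𝓡 hiding (sum; zero)
  open LinearAlgebra 𝓡
  open IntegerCoefficients 𝓡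
  open OrderedFieldProperties 𝓡
  open SemiringSum semiring using (sum; sum-cong-≋; ∑-comm; *-distribˡ-sum; *-distribʳ-sum)
  open SetoidReasoning setoid

  sum-nonNeg : ∀ {n} {f : ℝ^ n} → (∀ i → 0# ≤ f i) → 0# ≤ sum f
  sum-nonNeg {zero}  0≤f = ≤-refl
  sum-nonNeg {suc n} 0≤f = 0≤+ (0≤f zero) (sum-nonNeg (λ i → 0≤f (suc i)))

  sum≤0⇒≤0 : ∀ {n} {f : ℝ^ n} → (∀ i → 0# ≤ f i) → sum f ≤ 0# → ∀ i → f i ≤ 0#
  sum≤0⇒≤0 {suc n} {f} 0≤f Σ≤0 zero = ≤-trans
    (≤-from (sum-nonNeg (λ i → 0≤f (suc i)))
      (solve 2 (λ x s → s := x :+ s :- x) refl (f zero) (sum (tail f)))) Σ≤0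
  sum≤0⇒≤0 {suc n} {f} 0≤f Σ≤0 (suc i) = sum≤0⇒≤0 (λ i → 0≤f (suc i)) (≤-trans
    (≤-from (0≤f zero)
      (solve 2 (λ x s → x := x :+ s :- s) refl (f zero) (sum (tail f)))) Σ≤0) i

  ‖x‖₂²-nonNeg : ∀ {n} (x : ℝ^ n) → 0# ≤ ‖ x ‖₂²
  ‖x‖₂²-nonNeg x = sum-nonNeg (λ i → 0≤square (x i))

  ‖x‖₂²≤0⇒x≈0 : ∀ {n} {x : ℝ^ n} → ‖ x ‖₂² ≤ 0# → x ≈ᵥ 0ᵥ
  ‖x‖₂²≤0⇒x≈0 {x = x} le i = x*x≤0⇒x≈0 (sum≤0⇒≤0 (λ i → 0≤square (x i)) le i)

  x≉0⇒‖x‖₂²-pos : ∀ {n} {x : ℝ^ n} → ¬ (x ≈ᵥ 0ᵥ) → 0# < ‖ x ‖₂²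
  x≉0⇒‖x‖₂²-pos {x = x} x≉0 with positive? ‖ x ‖₂²
  ... | inj₁ pos = pos
  ... | inj₂ le  = contradiction (‖x‖₂²≤0⇒x≈0 le) x≉0

  ‖‖₂²-cong : ∀ {n} {x y : ℝ^ n} → x ≈ᵥ y → ‖ x ‖₂² ≈ ‖ y ‖₂²
  ‖‖₂²-cong x≈y = sum-cong-≋ (λ i → *-cong (x≈y i) (x≈y i))

  ∙-congˡ : ∀ {n} (u : ℝ^ n) {x y : ℝ^ n} → x ≈ᵥ y → u ∙ x ≈ u ∙ y
  ∙-congˡ u x≈y = sum-cong-≋ (λ i → *-congˡ (x≈y i))

  ∙-comm : ∀ {n} (u v : ℝ^ n) → u ∙ v ≈ v ∙ u
  ∙-comm u v = sum-cong-≋ (λ i → *-comm (u i) (v i))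

  ∙-zeroˡ : ∀ {n} (u : ℝ^ n) → 0ᵥ ∙ u ≈ 0#
  ∙-zeroˡ {zero}  u = refl
  ∙-zeroˡ {suc n} u = trans (+-cong (zeroˡ _) (∙-zeroˡ (tail u))) (+-identityˡ 0#)

  ∙-*ₛ : ∀ {n} (u : ℝ^ n) a x → u ∙ (a *ₛ x) ≈ a * (u ∙ x)
  ∙-*ₛ {zero} u a x = sym (zeroʳ a)
  ∙-*ₛ {suc n} u a x = trans (+-congˡ (∙-*ₛ (tail u) a (tail x)))
    (solve 4 (λ u a x s → u :* (a :* x) :+ a :* s := a :* (u :* x :+ s)) refl
      (u zero) a (x zero) (tail u ∙ tail x))

  ∙-+ᵥ : ∀ {n} (u x y : ℝ^ n) → u ∙ (x +ᵥ y) ≈ u ∙ x + u ∙ y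
  ∙-+ᵥ {zero} u x y = sym (+-identityˡ 0#)
  ∙-+ᵥ {suc n} u x y = trans (+-congˡ (∙-+ᵥ (tail u) (tail x) (tail y)))
    (solve 5 (λ u x y s t → u :* (x :+ y) :+ (s :+ t) := (u :* x :+ s) :+ (u :* y :+ t)) refl
      (u zero) (x zero) (y zero) (tail u ∙ tail x) (tail u ∙ tail y))

  ∙-ᵥ : ∀ {n} (u x y : ℝ^ n) → u ∙ (x -ᵥ y) ≈ u ∙ x - u ∙ y
  ∙-ᵥ {zero} u x y = sym (-‿inverseʳ 0#)
  ∙-ᵥ {suc n} u x y = trans (+-congˡ (∙-ᵥ (tail u) (tail x) (tail y)))
    (solve 5 (λ u x y s t → u :* (x :- y) :+ (s :- t) := (u :* x :+ s) :- (u :* y :+ t)) refl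
      (u zero) (x zero) (y zero) (tail u ∙ tail x) (tail u ∙ tail y))

  ∙-*ₛ-ᵥ : ∀ {n} (u : ℝ^ n) a x y → u ∙ (a *ₛ x -ᵥ y) ≈ a * (u ∙ x) - u ∙ y
  ∙-*ₛ-ᵥ u a x y = trans (∙-ᵥ u (a *ₛ x) y) (+-congʳ (∙-*ₛ u a x))

  ‖*ₛ‖₂² : ∀ {n} a (x : ℝ^ n) → ‖ a *ₛ x ‖₂² ≈ a * a * ‖ x ‖₂²
  ‖*ₛ‖₂² a x = trans (sum-cong-≋ (λ i → solve 2 (λ a x → a :* x :* (a :* x) := a :* a :* (x :* x)) refl a (x i)))
    (sym (*-distribˡ-sum (a * a) (map (λ t → t * t) x)))

  ‖*ₛ-‖₂² : ∀ {n} a (x y : ℝ^ n) →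
    ‖ a *ₛ x -ᵥ y ‖₂² ≈ a * a * ‖ x ‖₂² - fromℕ 2 * (a * (x ∙ y)) + ‖ y ‖₂²
  ‖*ₛ-‖₂² {zero} a x y =
    solve 1 (λ a → con (+ 0) := a :* a :* con (+ 0) :- con (+ 2) :* (a :* con (+ 0)) :+ con (+ 0)) refl a
  ‖*ₛ-‖₂² {suc n} a x y = trans (+-congˡ (‖*ₛ-‖₂² a (tail x) (tail y)))
    (solve 6 (λ a x y X Y s →
        (a :* x :- y) :* (a :* x :- y) :+ (a :* a :* X :- con (+ 2) :* (a :* s) :+ Y) :=
        a :* a :* (x :* x :+ X) :- con (+ 2) :* (a :* (x :* y :+ s)) :+ (y :* y :+ Y)) refl
      a (x zero) (y zero) ‖ tail x ‖₂² ‖ tail y ‖₂² (tail x ∙ tail y))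

  -- Both sides are the same double sum, with the two finite sums interchanged.
  adjoint : ∀ {m n} (H : Matrix m n) u r → (H *ᵥ u) ∙ r ≈ u ∙ (H ᵀ *ᵥ r)
  adjoint H u r = begin
    sum (λ i → (H i ∙ u) * r i)                    ≈⟨ sum-cong-≋ (λ i → *-distribʳ-sum (r i) (λ j → H i j * u j)) ⟩
    sum (λ i → sum (λ j → H i j * u j * r i))      ≈⟨ ∑-comm (λ i j → H i j * u j * r i) ⟩
    sum (λ j → sum (λ i → H i j * u j * r i))      ≈⟨ sum-cong-≋ (λ j → sum-cong-≋ (λ i →
      solve 3 (λ h u r → h :* u :* r := u :* (h :* r)) refl (H i j) (u j) (r i))) ⟩
    sum (λ j → sum (λ i → u j * (H i j * r i)))    ≈⟨ sum-cong-≋ (λ j → *-distribˡ-sum (u j) (λ i → H i j * r i)) ⟨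
    sum (λ j → u j * ((H ᵀ) j ∙ r))                ∎

  -- By symmetry of HᵀH, its row `i` is entrywise `H ᵀ` applied to column `i` of `H`, so that
  -- `adjoint` can move `H` onto `v`.
  ᵀ*ₘ-*ᵥ : ∀ {m n} (H : Matrix m n) v → (H ᵀ *ₘ H) *ᵥ v ≈ᵥ H ᵀ *ᵥ (H *ᵥ v)
  ᵀ*ₘ-*ᵥ H v i = begin
    (H ᵀ *ₘ H) i ∙ v                ≈⟨ ∙-comm _ v ⟩
    v ∙ (H ᵀ *ₘ H) i                ≈⟨ ∙-congˡ v (λ k → ∙-comm ((H ᵀ) i) ((H ᵀ) k)) ⟩
    v ∙ (H ᵀ *ᵥ (H ᵀ) i)            ≈⟨ adjoint H v ((H ᵀ) i) ⟨
    (H *ᵥ v) ∙ (H ᵀ) i              ≈⟨ ∙-comm (H *ᵥ v) _ ⟩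
    (H ᵀ *ᵥ (H *ᵥ v)) i             ∎

-- Quadratic forms and completing the square.

module SpectralBound {c ℓ₁ ℓ₂} (𝓡 : CompleteOrderedField c ℓ₁ ℓ₂) where
  open CompleteOrderedField 𝓡 hiding (sum; zero)
  open LinearAlgebra 𝓡
  open IntegerCoefficients 𝓡
  open OrderedFieldProperties 𝓡
  open VectorProperties 𝓡
  open SetoidReasoning setoid

  -- Recursion on the number of variables in place of a symmetric matrix: the first variable is
  -- already isolated, which is the shape that completing the square consumes.
  IsQuadratic : ∀ n → (ℝ^ n → Carrier) → Set (c ⊔ ℓ₁)
  IsQuadratic zero    q = ∀ v → q v ≈ 0#
  IsQuadratic (suc n) q = ∃₂ λ a β → ∃ λ q′ → IsQuadratic n q′ ×
    (∀ v → q v ≈ a * (v zero * v zero) + v zero * (β ∙ tail v) + q′ (tail v))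

  IsQuadratic-resp : ∀ {n p q} → (∀ v → p v ≈ q v) → IsQuadratic n p → IsQuadratic n q
  IsQuadratic-resp {zero}  p≈q p0 v = trans (sym (p≈q v)) (p0 v)
  IsQuadratic-resp {suc n} p≈q (a , β , p′ , Qp′ , eq) =
    a , β , p′ , Qp′ , λ v → trans (sym (p≈q v)) (eq v)

  combination : ∀ {n p q} k l → IsQuadratic n p → IsQuadratic n q →
                IsQuadratic n (λ v → k * p v + l * q v)
  combination {zero} k l p0 q0 v = trans (+-cong (*-congˡ (p0 v)) (*-congˡ (q0 v)))
    (solve 2 (λ k l → k :* con (+ 0) :+ l :* con (+ 0) := con (+ 0)) refl k l)
  combination {suc n} k l (a , β , p′ , Qp′ , p≈) (b , γ , q′ , Qq′ , q≈) =
    k * a + l * b , k *ₛ β +ᵥ l *ₛ γ , _ , combination k l Qp′ Qq′ , λ v →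
    let t = v zero; u = tail v in
    trans (+-cong (*-congˡ (p≈ v)) (*-congˡ (q≈ v)))
    (trans (solve 9 (λ k l a b t x y p q →
        k :* (a :* (t :* t) :+ t :* x :+ p) :+ l :* (b :* (t :* t) :+ t :* y :+ q) :=
        (k :* a :+ l :* b) :* (t :* t) :+ t :* (k :* x :+ l :* y) :+ (k :* p :+ l :* q)) refl
      k l a b t (β ∙ u) (γ ∙ u) (p′ u) (q′ u))
    (+-congʳ (+-congˡ (*-congˡ (sym (begin
      (k *ₛ β +ᵥ l *ₛ γ) ∙ u         ≈⟨ ∙-comm _ u ⟩
      u ∙ (k *ₛ β +ᵥ l *ₛ γ)         ≈⟨ ∙-+ᵥ u (k *ₛ β) (l *ₛ γ) ⟩
      u ∙ (k *ₛ β) + u ∙ (l *ₛ γ)    ≈⟨ +-cong (∙-*ₛ u k β) (∙-*ₛ u l γ) ⟩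
      k * (u ∙ β) + l * (u ∙ γ)      ≈⟨ +-cong (*-congˡ (∙-comm u β)) (*-congˡ (∙-comm u γ)) ⟩
      k * (β ∙ u) + l * (γ ∙ u)      ∎))))))

  linearForm²-isQuadratic : ∀ {n} (h : ℝ^ n) → IsQuadratic n (λ v → (h ∙ v) * (h ∙ v))
  linearForm²-isQuadratic {zero} h v = zeroˡ 0#
  linearForm²-isQuadratic {suc n} h =
    h zero * h zero , (fromℕ 2 * h zero) *ₛ tail h , _ , linearForm²-isQuadratic (tail h) , λ v →
    let t = v zero; u = tail v in
    trans (solve 3 (λ h t x →
        (h :* t :+ x) :* (h :* t :+ x) :=
        h :* h :* (t :* t) :+ t :* (con (+ 2) :* h :* x) :+ x :* x) refl (h zero) t (tail h ∙ u))
    (+-congʳ (+-congˡ (*-congˡ (sym (begin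
      ((fromℕ 2 * h zero) *ₛ tail h) ∙ u   ≈⟨ ∙-comm _ u ⟩
      u ∙ ((fromℕ 2 * h zero) *ₛ tail h)   ≈⟨ ∙-*ₛ u _ (tail h) ⟩
      fromℕ 2 * h zero * (u ∙ tail h)      ≈⟨ *-congˡ (∙-comm u (tail h)) ⟩
      fromℕ 2 * h zero * (tail h ∙ u)      ∎)))))

  0-isQuadratic : ∀ n → IsQuadratic n (λ _ → 0#)
  0-isQuadratic zero v = refl
  0-isQuadratic (suc n) = 0# , 0ᵥ , _ , 0-isQuadratic n , λ v → sym (trans
    (+-congʳ (+-congˡ (*-congˡ (∙-zeroˡ (tail v)))))
    (solve 1 (λ t → con (+ 0) :* (t :* t) :+ t :* con (+ 0) :+ con (+ 0) := con (+ 0)) refl (v zero)))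

  ‖‖₂²-isQuadratic : ∀ n → IsQuadratic n ‖_‖₂²
  ‖‖₂²-isQuadratic zero v = refl
  ‖‖₂²-isQuadratic (suc n) = 1# , 0ᵥ , _ , ‖‖₂²-isQuadratic n , λ v → sym (+-congʳ (trans
    (+-congˡ (*-congˡ (∙-zeroˡ (tail v))))
    (solve 1 (λ t → con (+ 1) :* (t :* t) :+ t :* con (+ 0) := t :* t) refl (v zero))))

  ‖*ᵥ‖₂²-isQuadratic : ∀ {m n} (H : Matrix m n) → IsQuadratic n (λ v → ‖ H *ᵥ v ‖₂²)
  ‖*ᵥ‖₂²-isQuadratic {zero} H = 0-isQuadratic _
  ‖*ᵥ‖₂²-isQuadratic {suc m} H = IsQuadratic-resp
    (λ v → +-cong (*-identityˡ _) (*-identityˡ _))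
    (combination 1# 1# (linearForm²-isQuadratic (H zero)) (‖*ᵥ‖₂²-isQuadratic (tail H)))

  -- Forms are bare functions with no assumed compatibility with `_≈ᵥ_`. This lemma evaluates them
  -- at scaled vectors, and with factor 0 it shows that they vanish at zero.
  homogeneous : ∀ {n q} → IsQuadratic n q → ∀ a v → q (a *ₛ v) ≈ a * a * q v
  homogeneous {zero} q0 a v = trans (q0 _) (sym (trans (*-congˡ (q0 v)) (zeroʳ _)))
  homogeneous {suc n} {q} (k , β , q′ , Qq′ , q≈) a v = begin
    q (a *ₛ v) ≈⟨ q≈ (a *ₛ v) ⟩
    k * (a * t * (a * t)) + a * t * (β ∙ (a *ₛ u)) + q′ (a *ₛ u)
      ≈⟨ +-cong (+-congˡ (*-congˡ (∙-*ₛ β a u))) (homogeneous Qq′ a u) ⟩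
    k * (a * t * (a * t)) + a * t * (a * (β ∙ u)) + a * a * q′ u
      ≈⟨ solve 5 (λ k a t b p →
           k :* (a :* t :* (a :* t)) :+ a :* t :* (a :* b) :+ a :* a :* p :=
           a :* a :* (k :* (t :* t) :+ t :* b :+ p)) refl k a t (β ∙ u) (q′ u) ⟩
    a * a * (k * (t * t) + t * (β ∙ u) + q′ u) ≈⟨ *-congˡ (q≈ v) ⟨
    a * a * q v ∎
    where t = v zero; u = tail v

  -- Iterating (a + b)² ≤ 2a² + 2b² over the coordinates gives a constant cruder than that of
  -- Cauchy-Schwarz; only its existence is used.
  linearForm-bound : ∀ {n} (h : ℝ^ n) → ∃ λ C → 0# ≤ C × (∀ v → (h ∙ v) * (h ∙ v) ≤ C * ‖ v ‖₂²)
  linearForm-bound {zero} h = 0# , ≤-refl , λ v → ≤-reflexive refl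
  linearForm-bound {suc n} h with linearForm-bound (tail h)
  ... | C , 0≤C , bound = fromℕ 2 * (h₀ * h₀ + C) ,
    *-nonNeg (fromℕ-nonNeg 2) (0≤+ (0≤square h₀) 0≤C) , λ v →
    let t = v zero; u = tail v; x = tail h ∙ u; N = ‖ u ‖₂² in
    ≤-from (0≤+ (0≤+ (0≤square (h₀ * t - x)) (*-nonNeg (fromℕ-nonNeg 2) (x≤y⇒0≤y-x (bound u))))
                (*-nonNeg (fromℕ-nonNeg 2) (0≤+ (*-nonNeg (0≤square h₀) (‖x‖₂²-nonNeg u))
                                                (*-nonNeg 0≤C (0≤square t)))))
      (solve 5 (λ h t x C N →
         (h :* t :- x) :* (h :* t :- x) :+ con (+ 2) :* (C :* N :- x :* x)
           :+ con (+ 2) :* (h :* h :* N :+ C :* (t :* t)) :=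
         con (+ 2) :* (h :* h :+ C) :* (t :* t :+ N) :- (h :* t :+ x) :* (h :* t :+ x))
       refl h₀ t x C N)
    where h₀ = h zero

  -- The bounds of the rows add up. This makes the Rayleigh quotients bounded above, so that their
  -- supremum exists; the sharp constant comes later.
  operator-bound : ∀ {m n} (H : Matrix m n) → ∃ λ C → ∀ v → ‖ H *ᵥ v ‖₂² ≤ C * ‖ v ‖₂²
  operator-bound {zero} H = 0# , λ v → ≤-reflexive (sym (zeroˡ _))
  operator-bound {suc m} H with linearForm-bound (H zero) | operator-bound (tail H)
  ... | C , _ , row | D , rows = C + D , λ v →
    ≤-from (0≤+ (x≤y⇒0≤y-x (row v)) (x≤y⇒0≤y-x (rows v)))
      (solve 5 (λ C D N x y → C :* N :- x :+ (D :* N :- y) := (C :+ D) :* N :- (x :+ y)) refl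
        C D ‖ v ‖₂² ((H zero ∙ v) * (H zero ∙ v)) ‖ tail H *ᵥ v ‖₂²)

  -- Completing the square in the first variable reduces q to the form
  -- 4a q′ - (β ∙ _)² in one variable less.
  coercive-or-degenerate : ∀ {n q} → IsQuadratic n q →
    (∃₂ λ k l → 0# < k × 0# < l × (∀ v → k * ‖ v ‖₂² ≤ l * q v)) ⊎
    (∃ λ v → 0# < ‖ v ‖₂² × q v ≤ 0#)
  coercive-or-degenerate {zero} q0 = inj₁ (1# , 1# , 0<1 , 0<1 , λ v → ≤-reflexive (*-congˡ (sym (q0 v))))
  coercive-or-degenerate {suc n} {q} (a , β , q′ , Qq′ , q≈) with positive? a
  ... | inj₂ a≤0 = inj₂ (v , +-pos (*-pos 0<1 0<1) (‖x‖₂²-nonNeg (tail v)) , ≤-respˡ (sym q≈a) a≤0)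
    where
    -- The first basis vector, where `q` equals `a`. Its tail is written as a multiple by 0 so that
    -- `homogeneous` applies to `q′`.
    v = 1# ∷ᵥ (0# *ₛ 0ᵥ)
    q≈a : q v ≈ a
    q≈a = trans (q≈ v) (trans
      (+-cong (+-congˡ (*-congˡ (∙-*ₛ β 0# 0ᵥ))) (homogeneous Qq′ 0# 0ᵥ))
      (solve 3 (λ a b p → a :* (con (+ 1) :* con (+ 1)) :+ con (+ 1) :* (con (+ 0) :* b)
                           :+ con (+ 0) :* con (+ 0) :* p := a) refl a (β ∙ 0ᵥ) (q′ 0ᵥ)))
  ... | inj₁ 0<a with coercive-or-degenerate
                        (combination (fromℕ 4 * a) (- 1#) Qq′ (linearForm²-isQuadratic β))
  ...   | inj₂ (u , 0<‖u‖² , q″u≤0) = inj₂ (v , 0<‖v‖² , qv≤0)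
    where
    b = β ∙ u
    -- With tail 2a u, `q` as a function of the first variable has its minimum at -b, with value a
    -- (4a q′ u - b²).
    v = (- b) ∷ᵥ ((fromℕ 2 * a) *ₛ u)
    0<2a = *-pos (fromℕ-pos 1) 0<a
    0<‖v‖² : 0# < ‖ v ‖₂²
    0<‖v‖² = <-respʳ (trans (+-congʳ (sym (‖*ₛ‖₂² (fromℕ 2 * a) u))) (+-comm _ _))
      (+-pos (*-pos (*-pos 0<2a 0<2a) 0<‖u‖²) (0≤square (- b)))
    qv≤0 : q v ≤ 0#
    qv≤0 = ≤-respˡ
      (sym (trans (q≈ v) (trans
        (+-cong (+-congˡ (*-congˡ (∙-*ₛ β (fromℕ 2 * a) u))) (homogeneous Qq′ (fromℕ 2 * a) u))
        (solve 3 (λ a b p →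
           a :* (:- b :* :- b) :+ :- b :* (con (+ 2) :* a :* b) :+ con (+ 2) :* a :* (con (+ 2) :* a) :* p :=
           a :* (con (+ 4) :* a :* p :+ :- con (+ 1) :* (b :* b))) refl a b (q′ u)))))
      (≤-respʳ (zeroʳ a) (*-monoˡ-≤ (proj₁ 0<a) q″u≤0))
  ...   | inj₁ (k , l , 0<k , 0<l , coercive) with linearForm-bound β
  ...     | C , 0≤C , bound = inj₁ (k * (fromℕ 4 * a * a) , (fromℕ 2 * k + K * l) * (fromℕ 4 * a) ,
    *-pos 0<k (*-pos (*-pos (fromℕ-pos 3) 0<a) 0<a) ,
    *-pos (+-pos (*-pos (fromℕ-pos 1) 0<k) (*-nonNeg 0≤K (proj₁ 0<l))) (*-pos (fromℕ-pos 3) 0<a) ,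
    λ v → ≤-respʳ (*-congˡ (sym (q≈ v))) (inequality (v zero) (tail v)))
    where
    -- With r = 2a t + b and q″ = 4a q′ - b², completing the square gives 4a q = r² + q″. From 2a t
    -- = r - b and b² ≤ C ‖u‖² follows 4a² (t² + ‖u‖²) ≤ 2 r² + K ‖u‖². Multiplying by k and using k
    -- ‖u‖² ≤ l q″ leaves 2k r² + K l q″, which is at most (2k + K l)(r² + q″).
    K = fromℕ 2 * C + fromℕ 4 * a * a
    0≤K : 0# ≤ K
    0≤K = 0≤+ (*-nonNeg (fromℕ-nonNeg 2) 0≤C) (*-nonNeg (*-nonNeg (fromℕ-nonNeg 4) (proj₁ 0<a)) (proj₁ 0<a))
    inequality : ∀ t u → k * (fromℕ 4 * a * a) * (t * t + ‖ u ‖₂²) ≤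
      (fromℕ 2 * k + K * l) * (fromℕ 4 * a) * (a * (t * t) + t * (β ∙ u) + q′ u)
    inequality t u = ≤-from
      (0≤+ (0≤+ (0≤+ (0≤+ (*-nonNeg (*-nonNeg (fromℕ-nonNeg 2) (proj₁ 0<k)) 0≤q″)
                          (*-nonNeg (*-nonNeg 0≤K (proj₁ 0<l)) (0≤square r)))
                     (*-nonNeg (proj₁ 0<k) (0≤square (r + b))))
                (*-nonNeg 0≤K (x≤y⇒0≤y-x (coercive u))))
           (*-nonNeg (*-nonNeg (fromℕ-nonNeg 2) (proj₁ 0<k)) (x≤y⇒0≤y-x (bound u))))
      (solve 8 (λ a t b p k l C N →
        let r = con (+ 2) :* a :* t :+ b
            K = con (+ 2) :* C :+ con (+ 4) :* a :* a
            q″ = con (+ 4) :* a :* p :+ :- con (+ 1) :* (b :* b)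
        in con (+ 2) :* k :* q″ :+ K :* l :* (r :* r) :+ k :* ((r :+ b) :* (r :+ b))
             :+ K :* (l :* q″ :- k :* N) :+ con (+ 2) :* k :* (C :* N :- b :* b) :=
           (con (+ 2) :* k :+ K :* l) :* (con (+ 4) :* a) :* (a :* (t :* t) :+ t :* b :+ p)
             :- k :* (con (+ 4) :* a :* a) :* (t :* t :+ N))
        refl a t b (q′ u) k l C ‖ u ‖₂²)
      where
      b = β ∙ u
      r = fromℕ 2 * a * t + b
      0≤q″ = *-cancelˡ-nonNeg 0<l (≤-trans (*-nonNeg (proj₁ 0<k) (‖x‖₂²-nonNeg u)) (coercive u))

  -- Rayleigh quotients and the largest eigenvalue of HᵀH.

  module _ {m n} (H : Matrix m n) where

    -- If μ ‖_‖² - ‖H _‖² is positive semidefinite and nonpositive at v, the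
    -- residual w = μ v - HᵀH v vanishes: otherwise the form would be negative
    -- at (μ + 1) v - w.
    degenerate⇒eigenvector : ∀ {μ} → 0# ≤ μ → (∀ v → ‖ H *ᵥ v ‖₂² ≤ μ * ‖ v ‖₂²) →
      ∀ v → μ * ‖ v ‖₂² ≤ ‖ H *ᵥ v ‖₂² → (H ᵀ *ₘ H) *ᵥ v ≈ᵥ μ *ₛ v
    degenerate⇒eigenvector {μ} 0≤μ bound v degenerate i = begin
      ((H ᵀ *ₘ H) *ᵥ v) i              ≈⟨ ᵀ*ₘ-*ᵥ H v i ⟩
      g i                              ≈⟨ solve 2 (λ x g → g := x :- (x :- g)) refl (μ * v i) (g i) ⟩
      μ * v i - w i                    ≈⟨ +-congˡ (-‿cong (‖x‖₂²≤0⇒x≈0 ‖w‖²≤0 i)) ⟩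
      μ * v i - 0#                     ≈⟨ solve 1 (λ x → x :- con (+ 0) := x) refl (μ * v i) ⟩
      μ * v i                          ∎
      where
      g = H ᵀ *ᵥ (H *ᵥ v)
      w = μ *ₛ v -ᵥ g
      p = μ + 1#
      z = p *ₛ v -ᵥ w
      ‖w‖²≈ : ‖ w ‖₂² ≈ μ * (v ∙ w) - (H *ᵥ v) ∙ (H *ᵥ w)
      ‖w‖²≈ = begin
        w ∙ w                                    ≈⟨ ∙-*ₛ-ᵥ w μ v g ⟩
        μ * (w ∙ v) - w ∙ g                      ≈⟨ +-cong (*-congˡ (∙-comm w v)) (-‿cong (sym (adjoint H w (H *ᵥ v)))) ⟩
        μ * (v ∙ w) - (H *ᵥ w) ∙ (H *ᵥ v)        ≈⟨ +-congˡ (-‿cong (∙-comm (H *ᵥ w) _)) ⟩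
        μ * (v ∙ w) - (H *ᵥ v) ∙ (H *ᵥ w)        ∎
      ‖Hz‖²≈ : ‖ H *ᵥ z ‖₂² ≈
        p * p * ‖ H *ᵥ v ‖₂² - fromℕ 2 * (p * ((H *ᵥ v) ∙ (H *ᵥ w))) + ‖ H *ᵥ w ‖₂²
      ‖Hz‖²≈ = trans (‖‖₂²-cong (λ j → ∙-*ₛ-ᵥ (H j) p v w)) (‖*ₛ-‖₂² p (H *ᵥ v) (H *ᵥ w))
      0≤qz : 0# ≤ μ * (p * p * ‖ v ‖₂² - fromℕ 2 * (p * (v ∙ w)) + ‖ w ‖₂²) -
        (p * p * ‖ H *ᵥ v ‖₂² - fromℕ 2 * (p * ((H *ᵥ v) ∙ (H *ᵥ w))) + ‖ H *ᵥ w ‖₂²)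
      0≤qz = ≤-respʳ (+-cong (*-congˡ (‖*ₛ-‖₂² p v w)) (-‿cong ‖Hz‖²≈)) (x≤y⇒0≤y-x (bound z))
      ‖w‖²≤0 : ‖ w ‖₂² ≤ 0#
      -- Let q be the form μ ‖_‖² - ‖H _‖². By `‖w‖²≈` its bilinear form at (v, w) is ‖w‖². Hence q
      -- z = p² q v - 2p ‖w‖² + q w, where q v ≤ 0 and q w ≤ μ ‖w‖². With p = μ + 1 the remaining
      -- factor is μ - 2p = -(2 + μ).
      ‖w‖²≤0 = *-cancelˡ-≤ {fromℕ 2 + μ} (+-pos (fromℕ-pos 1) 0≤μ) (≤-from
        (0≤+ (0≤+ 0≤qz (*-nonNeg (0≤square p) (x≤y⇒0≤y-x degenerate))) (‖x‖₂²-nonNeg (H *ᵥ w)))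
        (trans
          (solve 7 (λ μ V vw W HV HvHw HW → let p = μ :+ con (+ 1) in
            μ :* (p :* p :* V :- con (+ 2) :* (p :* vw) :+ W)
              :- (p :* p :* HV :- con (+ 2) :* (p :* HvHw) :+ HW)
              :+ p :* p :* (HV :- μ :* V) :+ HW :=
            μ :* W :- con (+ 2) :* p :* (μ :* vw :- HvHw)) refl
            μ ‖ v ‖₂² (v ∙ w) ‖ w ‖₂² ‖ H *ᵥ v ‖₂² ((H *ᵥ v) ∙ (H *ᵥ w)) ‖ H *ᵥ w ‖₂²)
          (trans (+-congˡ (-‿cong (*-congˡ (sym ‖w‖²≈))))
          (solve 2 (λ μ W →
            μ :* W :- con (+ 2) :* (μ :+ con (+ 1)) :* W :=
            (con (+ 2) :+ μ) :* con (+ 0) :- (con (+ 2) :+ μ) :* W) refl μ ‖ w ‖₂²))))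

    -- The numbers not exceeding some Rayleigh quotient, stated without division; the supremum is
    -- that of the quotients.
    Attained : Carrier → Set (c ⊔ ℓ₁ ⊔ ℓ₂)
    Attained ρ = ∃ λ v → 0# < ‖ v ‖₂² × ρ * ‖ v ‖₂² ≤ ‖ H *ᵥ v ‖₂²

    Attained-bound : ∀ {C} → (∀ v → ‖ H *ᵥ v ‖₂² ≤ C * ‖ v ‖₂²) → C ∈ UpperBound Attained
    Attained-bound {C} bound ρ (v , 0<N , att) = *-cancelˡ-≤ 0<N
      (≤-respˡ (*-comm ρ _) (≤-respʳ (*-comm C _) (≤-trans att (bound v))))

    rayleigh : ∀ {μ} → μ ∈ UpperBound Attained → ∀ v → ‖ H *ᵥ v ‖₂² ≤ μ * ‖ v ‖₂²
    rayleigh {μ} ub v with positive? ‖ v ‖₂²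
    ... | inj₁ 0<N = ≤-respˡ (*-/-cancel ‖ H *ᵥ v ‖₂² 0<N) (≤-respʳ (*-comm _ μ)
      (*-monoˡ-≤ (proj₁ 0<N) (ub (‖ H *ᵥ v ‖₂² / ‖ v ‖₂²)
        (v , 0<N , ≤-reflexive (trans (*-comm _ _) (*-/-cancel _ 0<N))))))
    -- A vector of norm zero has no quotient; there any operator bound gives 0 on the right, as μ
    -- does.
    ... | inj₂ N≤0 = ≤-respʳ (trans (*-congˡ N≈0) (trans (zeroʳ C) (sym (trans (*-congˡ N≈0) (zeroʳ μ)))))
      (proj₂ (operator-bound H) v)
      where
      C = proj₁ (operator-bound H)
      N≈0 = antisym N≤0 (‖x‖₂²-nonNeg v)

    ‖H*v‖₂²≤L*‖v‖₂² : ∀ {L} → IsLargestEigenvalue (H ᵀ *ₘ H) L → ∀ v → ‖ H *ᵥ v ‖₂² ≤ L * ‖ v ‖₂²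
    ‖H*v‖₂²≤L*‖v‖₂² {L} ((e , e≉0 , _) , largest) =
      -- The eigenvector for `L` is nonzero, so 0 lies in `Attained`; this gives both nonemptiness
      -- and 0 ≤ μ.
      let 0∈ = e , x≉0⇒‖x‖₂²-pos e≉0 , ≤-respˡ (sym (zeroˡ _)) (‖x‖₂²-nonNeg (H *ᵥ e))
          C , bound = operator-bound H
          μ , ub , least = supremum Attained (0# , 0∈) (C , Attained-bound bound)
          0≤μ = ub 0# 0∈
          bound-μ = rayleigh ub
          quadratic = combination μ (- 1#) (‖‖₂²-isQuadratic n) (‖*ᵥ‖₂²-isQuadratic H)
      in λ v → ≤-trans (bound-μ v) (≤-respˡ (*-comm _ μ) (≤-respʳ (*-comm _ L)
           (*-monoˡ-≤ (‖x‖₂²-nonNeg v) (μ≤L 0≤μ bound-μ least (coercive-or-degenerate quadratic)))))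
      where
      μ≤L : ∀ {μ} → 0# ≤ μ → (∀ v → ‖ H *ᵥ v ‖₂² ≤ μ * ‖ v ‖₂²) →
        (∀ u → u ∈ UpperBound Attained → μ ≤ u) →
        ((∃₂ λ k l → 0# < k × 0# < l ×
            (∀ v → k * ‖ v ‖₂² ≤ l * (μ * ‖ v ‖₂² + - 1# * ‖ H *ᵥ v ‖₂²))) ⊎
          (∃ λ v → 0# < ‖ v ‖₂² × μ * ‖ v ‖₂² + - 1# * ‖ H *ᵥ v ‖₂² ≤ 0#)) → μ ≤ L
      μ≤L {μ} 0≤μ bound-μ least (inj₂ (v , 0<N , q≤0)) =
        largest μ (v , (λ v≈0 → proj₂ 0<N (sym (N≈0 v≈0))) , degenerate⇒eigenvector 0≤μ bound-μ v
          (≤-from (x≤0⇒0≤-x q≤0) (solve 3 (λ μ N h → :- (μ :* N :+ :- con (+ 1) :* h) := h :- μ :* N) refl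
            μ ‖ v ‖₂² ‖ H *ᵥ v ‖₂²)))
        where
        N≈0 : v ≈ᵥ 0ᵥ → ‖ v ‖₂² ≈ 0#
        N≈0 v≈0 = trans (‖‖₂²-cong v≈0) (∙-zeroˡ {n} 0ᵥ)
      μ≤L {μ} 0≤μ bound-μ least (inj₁ (k , l , 0<k , 0<l , coercive)) =
        contradiction (least (μ - δ) (Attained-bound smaller)) (<⇒≰ μ-δ<μ)
        where
        -- Dividing coercivity by `l` yields ‖H v‖² ≤ (μ - δ) ‖v‖², so the smaller number μ - δ
        -- would bound `Attained`.
        δ = k / l
        0<δ = *-pos 0<k (⁻¹-pos 0<l)
        μ-δ<μ : μ - δ < μ
        μ-δ<μ = ≤-from (proj₁ 0<δ) (solve 2 (λ μ δ → δ := μ :- (μ :- δ)) refl μ δ) ,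
          λ eq → proj₂ 0<δ (sym (trans (solve 2 (λ μ δ → δ := μ :- (μ :- δ)) refl μ δ)
            (trans (+-congˡ (-‿cong eq)) (-‿inverseʳ μ))))
        smaller : ∀ v → ‖ H *ᵥ v ‖₂² ≤ (μ - δ) * ‖ v ‖₂²
        smaller v = *-cancelˡ-≤ 0<l (≤-from (x≤y⇒0≤y-x (coercive v)) (trans
          (+-congˡ (-‿cong (*-congʳ (sym (*-/-cancel k 0<l)))))
          (solve 5 (λ l δ μ N h →
            l :* (μ :* N :+ :- con (+ 1) :* h) :- l :* δ :* N :=
            l :* ((μ :- δ) :* N) :- l :* h) refl l δ μ ‖ v ‖₂² ‖ H *ᵥ v ‖₂²)))

-- Sorting and Chebyshev's sum inequality.

module OWLProperties {c ℓ₁ ℓ₂} (𝓡 : CompleteOrderedField c ℓ₁ ℓ₂) where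
  open CompleteOrderedField 𝓡 hiding (sum; zero)
  open LinearAlgebra 𝓡
  open OWL 𝓡
  open IntegerCoefficients 𝓡
  open OrderedFieldProperties 𝓡
  open VectorProperties 𝓡
  open SemiringSum semiring using (sum; sum-cong-≋)
  open Sort (Flip.decTotalOrder decTotalOrder) using (sort; sort-↭; sort-↗)
  open SetoidReasoning setoid

  Antitone : ∀ {n} → ℝ^ n → Set ℓ₂
  Antitone x = ∀ i j → i Fin.≤ j → x j ≤ x i

  sorted-antitone : ∀ {n} (x : ℝ^ n) → Antitone (sorted x)
  sorted-antitone x i j i≤j = Sorted.lookup-mono-≤
    (DecTotalOrder.totalOrder (Flip.decTotalOrder decTotalOrder)) (sort-↗ (toList x))
    (≡.subst₂ ℕ._≤_ (≡.sym (Fin.toℕ-cast _ i)) (≡.sym (Fin.toℕ-cast _ j)) i≤j)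

  -- The length equation is an irrelevant argument, so any proof of it can stand in for the one
  -- local to `sorted`.
  sum-lookup : ∀ {n} (l : List Carrier) .(eq : n ≡ List.length l) →
    sum (λ i → List.lookup l (Fin.cast eq i)) ≡ List.foldr _+_ 0# l
  sum-lookup {zero}  []      eq = ≡.refl
  sum-lookup {suc n} (x ∷ l) eq = ≡.cong (_+_ x) (sum-lookup l (≡.cong ℕ.pred eq))

  foldr-toList : ∀ {n} (x : ℝ^ n) → List.foldr _+_ 0# (toList x) ≡ sum x
  foldr-toList {zero}  x = ≡.refl
  foldr-toList {suc n} x = ≡.cong (_+_ (x zero)) (foldr-toList (tail x))

  -- Sorting permutes the list, and a fold in a commutative monoid ignores order; the outer steps
  -- pass between vectors and lists.
  sum-sorted : ∀ {n} (x : ℝ^ n) → sum (sorted x) ≈ sum x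
  sum-sorted x = begin
    sum (sorted x)                        ≡⟨ sum-lookup (sort (toList x))
      (≡.sym (≡.trans (↭-length (sort-↭ (toList x))) (length-tabulate x))) ⟩
    List.foldr _+_ 0# (sort (toList x))   ≈⟨ SetoidPermutation.foldr-commMonoid setoid +-isCommutativeMonoid
      (↭⇒↭ₛ′ isEquivalence (sort-↭ (toList x))) ⟩
    List.foldr _+_ 0# (toList x)          ≡⟨ foldr-toList x ⟩
    sum x                                 ∎

  -- The expression is the sum of (p - u i)(q - v i) multiplied out, and each factor is nonnegative.
  sum-products-of-drops : ∀ {n} p q (u v : ℝ^ n) → (∀ i → u i ≤ p) → (∀ i → v i ≤ q) →
    0# ≤ fromℕ n * (p * q) - p * sum v - q * sum u + u ∙ v
  sum-products-of-drops {zero} p q u v _ _ = ≤-reflexive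
    (solve 2 (λ p q → con (+ 0) := con (+ 0) :* (p :* q) :- p :* con (+ 0) :- q :* con (+ 0) :+ con (+ 0)) refl p q)
  sum-products-of-drops {suc n} p q u v u≤p v≤q = ≤-respʳ
    (solve 8 (λ p q u v N U V s →
       (p :- u) :* (q :- v) :+ (N :* (p :* q) :- p :* V :- q :* U :+ s) :=
       (con (+ 1) :+ N) :* (p :* q) :- p :* (v :+ V) :- q :* (u :+ U) :+ (u :* v :+ s)) refl
      p q (u zero) (v zero) (fromℕ n) (sum (tail u)) (sum (tail v)) (tail u ∙ tail v))
    (0≤+ (*-nonNeg (x≤y⇒0≤y-x (u≤p zero)) (x≤y⇒0≤y-x (v≤q zero)))
         (sum-products-of-drops p q (tail u) (tail v) (λ i → u≤p (suc i)) (λ i → v≤q (suc i))))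

  -- Induction on the length: prepending the largest entries p and q raises n (u ∙ v) - (sum u)(sum
  -- v) by exactly the sum of (p - u i)(q - v i) over the tails.
  chebyshev : ∀ {n} {u v : ℝ^ n} → Antitone u → Antitone v → sum u * sum v ≤ fromℕ n * (u ∙ v)
  chebyshev {zero} _ _ = ≤-reflexive refl
  chebyshev {suc n} {u} {v} u↘ v↘ = ≤-from
    (0≤+ (sum-products-of-drops (u zero) (v zero) (tail u) (tail v)
            (λ i → u↘ zero (suc i) ℕ.z≤n) (λ i → v↘ zero (suc i) ℕ.z≤n))
         (x≤y⇒0≤y-x (chebyshev {u = tail u} {tail v}
            (λ i j i≤j → u↘ (suc i) (suc j) (ℕ.s≤s i≤j))
            (λ i j i≤j → v↘ (suc i) (suc j) (ℕ.s≤s i≤j)))))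
    (solve 6 (λ p q N U V s →
       N :* (p :* q) :- p :* V :- q :* U :+ s :+ (N :* s :- U :* V) :=
       (con (+ 1) :+ N) :* (p :* q :+ s) :- (p :+ U) :* (q :+ V)) refl
      (u zero) (v zero) (fromℕ n) (sum (tail u)) (sum (tail v)) (tail u ∙ tail v))

  -- The OWL ball lies in a Euclidean ball.

  ‖x‖₁-nonNeg : ∀ {n} (x : ℝ^ n) → 0# ≤ ‖ x ‖₁
  ‖x‖₁-nonNeg x = sum-nonNeg (λ i → ∣x∣-nonNeg (x i))

  -- The difference consists of the cross terms of the squared sum of moduli, all nonnegative.
  ‖x‖₂²≤‖x‖₁² : ∀ {n} (x : ℝ^ n) → ‖ x ‖₂² ≤ ‖ x ‖₁ * ‖ x ‖₁
  ‖x‖₂²≤‖x‖₁² {zero} x = ≤-reflexive (sym (zeroˡ 0#))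
  ‖x‖₂²≤‖x‖₁² {suc n} x = ≤-from
    (0≤+ (x≤y⇒0≤y-x (‖x‖₂²≤‖x‖₁² (tail x)))
         (*-nonNeg (fromℕ-nonNeg 2) (*-nonNeg (∣x∣-nonNeg (x zero)) (‖x‖₁-nonNeg (tail x)))))
    (trans
      (solve 3 (λ a M N →
         M :* M :- N :+ con (+ 2) :* (a :* M) := (a :+ M) :* (a :+ M) :- (a :* a :+ N)) refl
        ∣ x zero ∣ ‖ tail x ‖₁ ‖ tail x ‖₂²)
      (+-congˡ (-‿cong (+-congʳ (∣x∣*∣x∣≈x*x (x zero))))))

  -- The average divides by the dimension; in dimension 0 every vector equals `0ᵥ` vacuously.
  x≉0⇒dimension-pos : ∀ {n} (x : ℝ^ n) → ¬ (x ≈ᵥ 0ᵥ) → 0# < fromℕ n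
  x≉0⇒dimension-pos {zero}  x x≉0 = contradiction (λ ()) x≉0
  x≉0⇒dimension-pos {suc n} x x≉0 = fromℕ-pos n

  module _ {n} {w : ℝ^ n} (w∈cone : w ∈ MonotoneNonNegCone) (w≉0 : ¬ (w ≈ᵥ 0ᵥ)) where

    ∣w∣≈w : ∀ i → ∣ w i ∣ ≈ w i
    ∣w∣≈w i = nonNeg⇒∣x∣≈x (proj₂ w∈cone i)

    ‖w‖₁-pos : 0# < ‖ w ‖₁
    ‖w‖₁-pos with positive? ‖ w ‖₁
    ... | inj₁ pos = pos
    ... | inj₂ le  = contradiction
      (λ i → antisym (≤-respˡ (∣w∣≈w i) (sum≤0⇒≤0 (λ j → ∣x∣-nonNeg (w j)) le i)) (proj₂ w∈cone i)) w≉0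

    average-pos : 0# < average w
    average-pos = *-pos ‖w‖₁-pos (⁻¹-pos (x≉0⇒dimension-pos w w≉0))

    -- Chebyshev's inequality for `w` and the sorted moduli, both nonincreasing: n times the average
    -- weight is ‖w‖₁, and sorting preserves the sum of moduli.
    average*‖x‖₁≤Ω : ∀ x → average w * ‖ x ‖₁ ≤ Ω w x
    average*‖x‖₁≤Ω x = *-cancelˡ-≤ (x≉0⇒dimension-pos w w≉0) (≤-respˡ (sym (begin
      fromℕ n * (average w * ‖ x ‖₁)            ≈⟨ *-assoc _ _ _ ⟨
      fromℕ n * average w * ‖ x ‖₁              ≈⟨ *-congʳ (*-/-cancel ‖ w ‖₁ (x≉0⇒dimension-pos w w≉0)) ⟩
      ‖ w ‖₁ * ‖ x ‖₁                           ≈⟨ *-cong (sum-cong-≋ ∣w∣≈w) (sym (sum-sorted (map ∣_∣ x))) ⟩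
      sum w * sum (sorted (map ∣_∣ x))          ∎))
      (chebyshev (proj₁ w∈cone) (sorted-antitone (map ∣_∣ x))))

    Ball⇒‖x‖₂²-bounded : ∀ {ε x} → x ∈ Ball w ε → average w * average w * ‖ x ‖₂² ≤ ε * ε
    Ball⇒‖x‖₂²-bounded {ε} {x} x∈B = ≤-trans
      (*-monoˡ-≤ (0≤square a) (‖x‖₂²≤‖x‖₁² x))
      -- With z = a ‖x‖₁ between 0 and ε, factor ε² - z² as (ε - z)(ε + z).
      (≤-from (*-nonNeg (x≤y⇒0≤y-x z≤ε) (0≤+ (≤-trans 0≤z z≤ε) 0≤z))
        (solve 3 (λ a M ε → (ε :- a :* M) :* (ε :+ a :* M) := ε :* ε :- a :* a :* (M :* M)) refl a ‖ x ‖₁ ε))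
      where
      a = average w
      0≤z : 0# ≤ a * ‖ x ‖₁
      0≤z = *-nonNeg (proj₁ average-pos) (‖x‖₁-nonNeg x)
      z≤ε : a * ‖ x ‖₁ ≤ ε
      z≤ε = ≤-trans (average*‖x‖₁≤Ω x) x∈B

-- Convexity of the squared norm and the scalar recurrence.

module ConditionalGradient {c ℓ₁ ℓ₂} (𝓡 : CompleteOrderedField c ℓ₁ ℓ₂) where
  open CompleteOrderedField 𝓡 hiding (sum; zero)
  open LinearAlgebra 𝓡
  open Optimization 𝓡
  open OWL 𝓡
  open IntegerCoefficients 𝓡
  open OrderedFieldProperties 𝓡
  open VectorProperties 𝓡
  open SpectralBound 𝓡 using (‖H*v‖₂²≤L*‖v‖₂²)
  open OWLProperties 𝓡
  open SemiringMult semiring using (×-homo-+)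
  open SetoidReasoning setoid

  -- Parallelogram law: the two sides differ by ‖s + x‖². It bounds the diameter of a Euclidean ball
  -- without square roots.
  ‖s-x‖₂²≤2‖s‖₂²+2‖x‖₂² : ∀ {n} (s x : ℝ^ n) → ‖ s -ᵥ x ‖₂² ≤ fromℕ 2 * (‖ s ‖₂² + ‖ x ‖₂²)
  ‖s-x‖₂²≤2‖s‖₂²+2‖x‖₂² {zero} s x = ≤-reflexive (sym (trans (*-congˡ (+-identityˡ 0#)) (zeroʳ _)))
  ‖s-x‖₂²≤2‖s‖₂²+2‖x‖₂² {suc n} s x = ≤-from
    (0≤+ (0≤square (s zero + x zero)) (x≤y⇒0≤y-x (‖s-x‖₂²≤2‖s‖₂²+2‖x‖₂² (tail s) (tail x))))
    (solve 5 (λ s x S X D →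
       (s :+ x) :* (s :+ x) :+ (con (+ 2) :* (S :+ X) :- D) :=
       con (+ 2) :* (s :* s :+ S :+ (x :* x :+ X)) :- ((s :- x) :* (s :- x) :+ D)) refl
      (s zero) (x zero) ‖ tail s ‖₂² ‖ tail x ‖₂² ‖ tail s -ᵥ tail x ‖₂²)

  -- The right side exceeds the left by t (1 - t) ‖s - x‖².
  ‖‖₂²-convex : ∀ {n} {t} → t ∈ UnitInterval → ∀ (x s : ℝ^ n) →
    ‖ x +ᵥ t *ₛ (s -ᵥ x) ‖₂² ≤ (1# - t) * ‖ x ‖₂² + t * ‖ s ‖₂²
  ‖‖₂²-convex {zero} {t} _ x s = ≤-reflexive
    (solve 1 (λ t → con (+ 0) := (con (+ 1) :- t) :* con (+ 0) :+ t :* con (+ 0)) refl t)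
  ‖‖₂²-convex {suc n} {t} t∈I@(0≤t , t≤1) x s = ≤-from
    (0≤+ (*-nonNeg (*-nonNeg 0≤t (x≤y⇒0≤y-x t≤1)) (0≤square (s zero - x zero)))
         (x≤y⇒0≤y-x (‖‖₂²-convex t∈I (tail x) (tail s))))
    (solve 6 (λ t x s X S Z →
       t :* (con (+ 1) :- t) :* ((s :- x) :* (s :- x)) :+ ((con (+ 1) :- t) :* X :+ t :* S :- Z) :=
       (con (+ 1) :- t) :* (x :* x :+ X) :+ t :* (s :* s :+ S)
         :- ((x :+ t :* (s :- x)) :* (x :+ t :* (s :- x)) :+ Z)) refl
      t (x zero) (s zero) ‖ tail x ‖₂² ‖ tail s ‖₂² ‖ tail x +ᵥ t *ₛ (tail s -ᵥ tail x) ‖₂²)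

  -- The step size t = 2/(k + 2) gives the rate.  The induction hypothesis is
  -- multiplied by k, which makes it vacuous for k = 0.
  recurrence⇒rate : ∀ (G : ℕ → Carrier) {A} → 0# ≤ A →
    (∀ k t → t ∈ UnitInterval → G (suc k) ≤ G k - t * G k + fromℕ 4 * (t * t * A)) →
    ∀ k → fromℕ (suc k ℕ.+ 2) * G (suc k) ≤ fromℕ 16 * A
  recurrence⇒rate G {A} 0≤A step k = ≤-respˡ (*-congʳ (+-congˡ (sym (×-homo-+ 1# k 2))))
    -- Multiply by N², where N = k + 2 and N t = 2. The coefficient of G k becomes N² - 2N = N k,
    -- which the hypothesis controls. The terms in A amount to 16 ((N + 1)(N - 1) + 1) = 16 N², the
    -- final 16 A being the slack.
    (*-cancelˡ-≤ (*-pos 0<N 0<N) (≤-from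
    (0≤+ (0≤+ (*-nonNeg 0≤1+N (x≤y⇒0≤y-x scaled-step))
              (*-nonNeg 0≤1+N (x≤y⇒0≤y-x (hypothesis k))))
         (*-nonNeg (fromℕ-nonNeg 16) 0≤A))
    (trans (+-congʳ (+-cong (*-congˡ (+-congʳ expand)) refl))
    (solve 4 (λ M A g g′ → let N = M :+ con (+ 2) in
        (con (+ 1) :+ N) :* (N :* N :* g :- N :* (con (+ 2) :* g) :+ con (+ 4) :* (con (+ 2) :* con (+ 2) :* A) :- N :* N :* g′)
          :+ (con (+ 1) :+ N) :* (M :* (con (+ 16) :* A) :- M :* (N :* g)) :+ con (+ 16) :* A :=
        N :* N :* (con (+ 16) :* A) :- N :* N :* ((con (+ 1) :+ N) :* g′)) refl M A (G k) (G (suc k))))))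
    where
    M = fromℕ k
    N = M + fromℕ 2
    0<N : 0# < N
    0<N = <-respʳ (+-comm _ M) (+-pos (fromℕ-pos 1) (fromℕ-nonNeg k))
    0≤1+N = 0≤+ 0≤1 (proj₁ 0<N)
    t = fromℕ 2 / N
    Nt≈2 : N * t ≈ fromℕ 2
    Nt≈2 = *-/-cancel (fromℕ 2) 0<N
    t∈I : t ∈ UnitInterval
    t∈I = *-nonNeg (fromℕ-nonNeg 2) (proj₁ (⁻¹-pos 0<N)) ,
      *-cancelˡ-≤ 0<N (≤-respˡ (sym Nt≈2) (≤-from (fromℕ-nonNeg k)
        (solve 1 (λ M → M := (M :+ con (+ 2)) :* con (+ 1) :- con (+ 2)) refl M)))
    hypothesis : ∀ k → fromℕ k * ((fromℕ k + fromℕ 2) * G k) ≤ fromℕ k * (fromℕ 16 * A)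
    hypothesis zero    = ≤-reflexive (trans (zeroˡ _) (sym (zeroˡ _)))
    hypothesis (suc k) = *-monoˡ-≤ (fromℕ-nonNeg (suc k))
      (≤-respˡ (*-congʳ (×-homo-+ 1# (suc k) 2)) (recurrence⇒rate G 0≤A step k))
    scaled-step : N * N * G (suc k) ≤ N * N * (G k - t * G k + fromℕ 4 * (t * t * A))
    scaled-step = *-monoˡ-≤ (0≤square N) (step k t t∈I)
    expand : N * N * (G k - t * G k + fromℕ 4 * (t * t * A)) ≈
      N * N * G k - N * (fromℕ 2 * G k) + fromℕ 4 * (fromℕ 2 * fromℕ 2 * A)
    expand = trans
      (solve 4 (λ N t g A →
         N :* N :* (g :- t :* g :+ con (+ 4) :* (t :* t :* A)) :=
         N :* N :* g :- N :* (N :* t :* g) :+ con (+ 4) :* (N :* t :* (N :* t) :* A)) refl N t (G k) A)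
      (+-cong (+-congˡ (-‿cong (*-congˡ (*-congʳ Nt≈2)))) (*-congˡ (*-congʳ (*-cong Nt≈2 Nt≈2))))

  -- The objective along a segment.

  module _ {m n} (H : Matrix m n) (y : ℝ^ m) where
    open LeastSquares H y

    -- Twice `objective`. Clearing the factor 1/2 keeps the certificates within integer
    -- coefficients.
    residual² : ℝ^ n → Carrier
    residual² x = ‖ H *ᵥ x -ᵥ y ‖₂²

    2*objective : ∀ x → fromℕ 2 * objective x ≈ residual² x
    2*objective x = trans (sym (*-assoc _ _ _))
      (trans (*-congʳ (inverseʳ (fromℕ-pos 1))) (*-identityˡ _))

    objective-≤⇒residual²-≤ : ∀ {x z} → objective x ≤ objective z → residual² x ≤ residual² z
    objective-≤⇒residual²-≤ {x} {z} le = ≤-respˡ (2*objective x) (≤-respʳ (2*objective z)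
      (*-monoˡ-≤ (fromℕ-nonNeg 2) le))

    residual²-cong : ∀ {x z} → x ≈ᵥ z → residual² x ≈ residual² z
    residual²-cong x≈z = ‖‖₂²-cong (λ i → +-congʳ (∙-congˡ (H i) x≈z))

    -- Exact second order expansion at `x`. The linear term pairs the residual with H (s - x), and
    -- `adjoint` turns it into an inner product with the negative gradient.
    residual²-along : ∀ x s t → residual² (x +ᵥ t *ₛ (s -ᵥ x)) ≈
      t * t * ‖ H *ᵥ (s -ᵥ x) ‖₂² - fromℕ 2 * (t * (s ∙ negGradient x - x ∙ negGradient x)) + residual² x
    residual²-along x s t = begin
      residual² (x +ᵥ t *ₛ d)
        ≈⟨ ‖‖₂²-cong (λ i → trans (+-congʳ (trans (∙-+ᵥ (H i) x (t *ₛ d)) (+-congˡ (∙-*ₛ (H i) t d))))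
             (solve 4 (λ a t b c → a :+ t :* b :- c := t :* b :- (c :- a)) refl (H i ∙ x) t (H i ∙ d) (y i))) ⟩
      ‖ t *ₛ (H *ᵥ d) -ᵥ r ‖₂²
        ≈⟨ ‖*ₛ-‖₂² t (H *ᵥ d) r ⟩
      t * t * ‖ H *ᵥ d ‖₂² - fromℕ 2 * (t * ((H *ᵥ d) ∙ r)) + ‖ r ‖₂²
        ≈⟨ +-cong (+-congˡ (-‿cong (*-congˡ (*-congˡ Hd∙r≈)))) ‖r‖²≈ ⟩
      t * t * ‖ H *ᵥ d ‖₂² - fromℕ 2 * (t * (s ∙ g - x ∙ g)) + residual² x ∎
      where
      d = s -ᵥ x
      r = y -ᵥ H *ᵥ x
      g = negGradient x
      Hd∙r≈ : (H *ᵥ d) ∙ r ≈ s ∙ g - x ∙ g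
      Hd∙r≈ = begin
        (H *ᵥ d) ∙ r     ≈⟨ adjoint H d r ⟩
        d ∙ g            ≈⟨ ∙-comm d g ⟩
        g ∙ d            ≈⟨ ∙-ᵥ g s x ⟩
        g ∙ s - g ∙ x    ≈⟨ +-cong (∙-comm g s) (-‿cong (∙-comm g x)) ⟩
        s ∙ g - x ∙ g    ∎
      ‖r‖²≈ : ‖ r ‖₂² ≈ residual² x
      ‖r‖²≈ = SemiringSum.sum-cong-≋ semiring (λ i →
        solve 2 (λ a b → (b :- a) :* (b :- a) := (a :- b) :* (a :- b)) refl (H i ∙ x) (y i))

    -- Convergence rate of the iterates.

    module Convergence {w : ℝ^ n} {ε : Carrier}
      (w∈cone : w ∈ MonotoneNonNegCone) (w≉0 : ¬ (w ≈ᵥ 0ᵥ))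
      {x* : ℝ^ n} (x*-optimal : x* ∈ ArgMin objective (Ball w ε))
      {L : Carrier} (L-largest : IsLargestEigenvalue (H ᵀ *ₘ H) L)
      {x s : ℕ → ℝ^ n} {γ : ℕ → Carrier} (run : IsConditionalGradient w ε x s γ) where
      open IsConditionalGradient run

      private
        -- Inequalities are carried multiplied by the squared average weight, which is divided out
        -- only in `rate`.
        W = average w * average w
        E = L * (ε * ε)

      -- The spectral bound at an eigenvector e reads 0 ≤ ‖H e‖² ≤ L ‖e‖², with ‖e‖² > 0.
      L-nonNeg : 0# ≤ L
      L-nonNeg = let e , e≉0 , _ = proj₁ L-largest in *-cancelˡ-nonNeg (x≉0⇒‖x‖₂²-pos e≉0)
        (≤-respʳ (*-comm L _) (≤-trans (‖x‖₂²-nonNeg (H *ᵥ e)) (‖H*v‖₂²≤L*‖v‖₂² H L-largest e)))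

      -- The iterates are only tracked in a Euclidean ball containing the OWL
      -- ball, which avoids proving that Ω is convex.
      iterate-bounded : ∀ k → W * ‖ x k ‖₂² ≤ ε * ε
      iterate-bounded zero = Ball⇒‖x‖₂²-bounded w∈cone w≉0 initial
      iterate-bounded (suc k) = ≤-respˡ (*-congˡ (sym (‖‖₂²-cong (update k))))
        (≤-trans (*-monoˡ-≤ (0≤square (average w)) (‖‖₂²-convex γ∈I (x k) (s k)))
        (≤-from (0≤+ (*-nonNeg (x≤y⇒0≤y-x (proj₂ γ∈I)) (x≤y⇒0≤y-x (iterate-bounded k)))
                     (*-nonNeg (proj₁ γ∈I) (x≤y⇒0≤y-x (Ball⇒‖x‖₂²-bounded w∈cone w≉0 (proj₁ (oracle k))))))
          (solve 5 (λ γ W X S e →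
             (con (+ 1) :- γ) :* (e :- W :* X) :+ γ :* (e :- W :* S) :=
             e :- W :* ((con (+ 1) :- γ) :* X :+ γ :* S)) refl (γ k) W ‖ x k ‖₂² ‖ s k ‖₂² (ε * ε))))
        where γ∈I = proj₁ (lineSearch k)

      -- Twice the suboptimality, which is why the recurrence ends in 16 and the rate in 8.
      gap : ℕ → Carrier
      gap k = residual² (x k) - residual² x*

      -- Expanding at step 1 towards `x*` and dropping ‖H (x* - x k)‖² is convexity; the oracle then
      -- allows `s k` in place of `x*`. The right side is twice the Frank-Wolfe duality gap.
      gap≤linearised-gap : ∀ k → gap k ≤ fromℕ 2 * (s k ∙ negGradient (x k) - x k ∙ negGradient (x k))
      gap≤linearised-gap k = ≤-from
        (0≤+ (‖x‖₂²-nonNeg (H *ᵥ (x* -ᵥ x k)))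
             (*-nonNeg (fromℕ-nonNeg 2) (x≤y⇒0≤y-x (proj₂ (oracle k) x* (proj₁ x*-optimal)))))
        (trans (solve 5 (λ h a b c F →
             h :+ con (+ 2) :* (b :- a) :=
             con (+ 2) :* (b :- c) :- (F :- (con (+ 1) :* con (+ 1) :* h :- con (+ 2) :* (con (+ 1) :* (a :- c)) :+ F)))
             refl ‖ H *ᵥ (x* -ᵥ x k) ‖₂² (x* ∙ g) (s k ∙ g) (x k ∙ g) (residual² (x k)))
          (+-congˡ (-‿cong (+-congˡ (-‿cong (trans (sym (residual²-along (x k) x* 1#))
            (residual²-cong (λ i → solve 2 (λ a b → a :+ con (+ 1) :* (b :- a) := b) refl (x k i) (x* i)))))))))
        where g = negGradient (x k)

      -- Exact line search does at least as well as any fixed `t` in the unit interval. The linear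
      -- term yields the decrease by t times the gap, and W ‖H (s - x)‖² ≤ L W ‖s - x‖² ≤ 4 L ε²
      -- yields the constant 4.
      gap-recurrence : ∀ k t → t ∈ UnitInterval →
        W * gap (suc k) ≤ W * gap k - t * (W * gap k) + fromℕ 4 * (t * t * E)
      gap-recurrence k t t∈I = ≤-from
        (0≤+ (0≤+ (0≤+ (0≤+
          (*-nonNeg 0≤W (x≤y⇒0≤y-x descent))
          (*-nonNeg (*-nonNeg 0≤W (proj₁ t∈I)) (x≤y⇒0≤y-x (gap≤linearised-gap k))))
          (*-nonNeg (*-nonNeg 0≤W (0≤square t)) (x≤y⇒0≤y-x (‖H*v‖₂²≤L*‖v‖₂² H L-largest d))))
          (*-nonNeg (*-nonNeg (*-nonNeg 0≤W (0≤square t)) L-nonNeg)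
            (x≤y⇒0≤y-x (‖s-x‖₂²≤2‖s‖₂²+2‖x‖₂² (s k) (x k)))))
          (*-nonNeg (*-nonNeg (fromℕ-nonNeg 2) (*-nonNeg (0≤square t) L-nonNeg))
            (0≤+ (x≤y⇒0≤y-x (Ball⇒‖x‖₂²-bounded w∈cone w≉0 (proj₁ (oracle k))))
                 (x≤y⇒0≤y-x (iterate-bounded k)))))
        (solve 12 (λ W t L e F* F F′ δ h D S X →
            W :* (t :* t :* h :- con (+ 2) :* (t :* δ) :+ F :- F′)
              :+ W :* t :* (con (+ 2) :* δ :- (F :- F*))
              :+ W :* (t :* t) :* (L :* D :- h)
              :+ W :* (t :* t) :* L :* (con (+ 2) :* (S :+ X) :- D)
              :+ con (+ 2) :* (t :* t :* L) :* (e :- W :* S :+ (e :- W :* X)) :=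
            W :* (F :- F*) :- t :* (W :* (F :- F*)) :+ con (+ 4) :* (t :* t :* (L :* e)) :- W :* (F′ :- F*)) refl
          W t L (ε * ε) (residual² x*) (residual² (x k)) (residual² (x (suc k)))
          δ h ‖ d ‖₂² ‖ s k ‖₂² ‖ x k ‖₂²)
        where
        d = s k -ᵥ x k
        δ = s k ∙ negGradient (x k) - x k ∙ negGradient (x k)
        h = ‖ H *ᵥ d ‖₂²
        0≤W = 0≤square (average w)
        descent : residual² (x (suc k)) ≤ t * t * h - fromℕ 2 * (t * δ) + residual² (x k)
        descent = ≤-respˡ (sym (residual²-cong (update k))) (≤-respʳ (residual²-along (x k) (s k) t)
          (objective-≤⇒residual²-≤ (proj₂ (lineSearch k) t t∈I)))

      rate : ∀ k → objective (x (suc k)) - objective x* ≤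
        (fromℕ 8 * (ε * ε) * L) / (W * fromℕ (suc k ℕ.+ 2))
      rate k = ≤-/ (*-pos (*-pos 0<a 0<a) (fromℕ-pos (k ℕ.+ 2)))
        (*-cancelˡ-≤ (fromℕ-pos 1) (≤-respˡ lhs≈ (≤-respʳ
          (solve 2 (λ L e → con (+ 16) :* (L :* e) := con (+ 2) :* (con (+ 8) :* e :* L)) refl L (ε * ε))
          (recurrence⇒rate (λ j → W * gap j) (*-nonNeg L-nonNeg (0≤square ε)) gap-recurrence k))))
        where
        0<a = average-pos w∈cone w≉0
        N = fromℕ (suc k ℕ.+ 2)
        lhs≈ : N * (W * gap (suc k)) ≈ fromℕ 2 * (W * N * (objective (x (suc k)) - objective x*))
        lhs≈ = trans (*-congˡ (*-congˡ (sym (+-cong (2*objective (x (suc k))) (-‿cong (2*objective x*))))))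
          (solve 4 (λ N W f f* →
             N :* (W :* (con (+ 2) :* f :- con (+ 2) :* f*)) := con (+ 2) :* (W :* N :* (f :- f*))) refl
            N W (objective (x (suc k))) (objective x*))

theorem2 :
  ∀ {c ℓ₁ ℓ₂} (𝓡 : CompleteOrderedField c ℓ₁ ℓ₂) →
    let open CompleteOrderedField 𝓡
        open LinearAlgebra 𝓡
        open Optimization 𝓡
        open OWL 𝓡
    in
    ∀ {m n} (H : Matrix m n) (y : ℝ^ m) (w : ℝ^ n) (ε : Carrier) →
    let open LeastSquares H y renaming (objective to f) in
    w ∈ MonotoneNonNegCone → ¬ (w ≈ᵥ 0ᵥ) → 0# < ε →
    ∀ (x* : ℝ^ n) → x* ∈ ArgMin f (Ball w ε) →
    ∀ (L : Carrier) → IsLargestEigenvalue (H ᵀ *ₘ H) L →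
    ∀ (x s : ℕ → ℝ^ n) (γ : ℕ → Carrier) →
    IsConditionalGradient w ε x s γ →
    ∀ (k : ℕ) → 1 ℕ.≤ k →
    f (x k) - f x* ≤ (fromℕ 8 * (ε * ε) * L) / ((average w * average w) * fromℕ (k ℕ.+ 2))
-- The estimate is for iterates produced by at least one step, so 1 ≤ k is matched as a successor.
theorem2 𝓡 H y w ε w∈cone w≉0 _ x* x*-optimal L L-largest x s γ run (suc k) _ =
  ConditionalGradient.Convergence.rate 𝓡 H y w∈cone w≉0 x*-optimal L-largest run k
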